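{- Every function $f:\mathbb N^n\to\mathbb N$ that is representable in $\lambda\mu$T is representable in $\lambda$T. That is, if a $\lambda\mu$T-term $t$ with $\emptyset;\emptyset\vdash t:\mathbb N^n\to\mathbb N$ satisfies $t\,\overline{m_1}\cdots\overline{m_n}=\overline{f(m_1,\dots,m_n)}$ in $\lambda\mu$T for all $m_1,\dots,m_n\in\mathbb N$, then there exists a $\lambda$T-term $t'$ with $\vdash t':\mathbb N^n\to\mathbb N$ such that $t'\,\overline{m_1}\cdots\overline{m_n}=\overline{f(m_1,\dots,m_n)}$ in $\lambda$T for all $m_1,\dots,m_n\in\mathbb N$.
   Context: $\mathbb N^n\to\mathbb N$ abbreviates $\mathbb N\to\cdots\to\mathbb N\to\mathbb N$ ($n$ arguments); $\overline n:=\mathsf S^n0$. $\lambda$T (Gödel's T): types $\rho ::= \mathbb N\mid\sigma\to\tau$; terms $t ::= x\mid\lambda x{:}\rho.r\mid ts\mid0\mid\mathsf S\,t\mid\mathsf{nrec}_\rho\ r\ s\ t$; typing by the simply typed rules plus $\vdash0:\mathbb N$, $t:\mathbb N\Rightarrow\mathsf S t:\mathbb N$, and $r:\rho$, $s:\mathbb N\to\rho\to\rho$, $t:\mathbb N\Rightarrow\mathsf{nrec}_\rho\ r\ s\ t:\rho$; reduction is the compatible closure of $(\lambda x.t)r\to t[x:=r]$, $\mathsf{nrec}\ r\ s\ 0\to r$, $\mathsf{nrec}\ r\ s\ (\mathsf S t)\to s\ t\ (\mathsf{nrec}\ r\ s\ t)$; $=$ is conversion. $\lambda\mu$T: terms/commands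 $t ::= x\mid\lambda x{:}\rho.r\mid ts\mid\mu\alpha{:}\rho.c\mid0\mid\mathsf S\,t\mid\mathsf{nrec}_\rho\ r\ s\ t$, $c::=[\alpha]t$; typing $\Gamma;\Delta\vdash t:\rho$ by the $\lambda$T rules plus $\Gamma;\Delta,\alpha{:}\rho\vdash c\Rightarrow\Gamma;\Delta\vdash\mu\alpha{:}\rho.c:\rho$ and $\Gamma;\Delta\vdash t:\rho$, $\alpha:\rho\in\Delta\Rightarrow\Gamma;\Delta\vdash[\alpha]t$. Contexts $E ::= \Box \mid E\,t \mid \mathsf S\,E \mid \mathsf{nrec}\ r\ s\ E$; structural substitution $t[\alpha:=\beta E]$ replaces recursively each subcommand $[\alpha]q$ by $[\beta]E[q[\alpha:=\beta E]]$. Reduction is the compatible closure of: $(\lambda x.t)r \to t[x:=r]$; $\mathsf S(\mu\alpha.c)\to \mu\alpha.c[\alpha:=\alpha(\mathsf S\Box)]$; $(\mu\alpha.c)s\to\mu\alpha.c[\alpha:=\alpha(\Box s)]$; $\mu\alpha.[\alpha]t\to t$ if $\alpha\notin\mathrm{FCV}(t)$; $[\alpha]\mu\beta.c\to c[\beta:=\alpha\,\Box]$; $\mathsf{nrec}\ r\ s\ 0\to r$; $\mathsf{nrec}\ r\ s\ (\mathsf S\,\overline n)\to s\ \overline n\ (\mathsf{nrec}\ r\ s\ \overline n)$; $\mathsf{nrec}\ r\ s\ (\mu\alpha.c)\to\mu\alpha.c[\alpha:=\alpha(\mathsf{nrec}\ r\ s\ \Box)]$; $=$ is conversion. -}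

module Defs where

-- Gödel's T (λT) and its classical extension λμT, as raw terms with
-- de Bruijn indices (for term variables, and separately for the
-- continuation / μ-variables of λμT), typing judgements, one-step
-- reduction (compatible closure) and conversion (equivalence closure).

open import Data.Nat using (ℕ; zero; suc; pred; _≟_)
open import Data.List using (List; []; _∷_)
open import Data.Vec using (Vec; []; _∷_)
open import Relation.Nullary using (yes; no)
open import Relation.Binary.Construct.Closure.Equivalence using (EqClosure)

infixr 7 _⇒_
data Ty : Set where
  N   : Ty
  _⇒_ : Ty → Ty → Ty

-- ℕ^n → ℕ  =  ℕ → ⋯ → ℕ → ℕ  (n arguments)
arrN : ℕ → Ty
arrN zero    = N
arrN (suc n) = N ⇒ arrN n

Ctx : Set
Ctx = List Ty

data _∋_∶_ : Ctx → ℕ → Ty → Set where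
  here  : ∀ {Γ ρ} → (ρ ∷ Γ) ∋ zero ∶ ρ
  there : ∀ {Γ ρ σ x} → Γ ∋ x ∶ ρ → (σ ∷ Γ) ∋ suc x ∶ ρ

ext : (ℕ → ℕ) → ℕ → ℕ
ext f zero    = zero
ext f (suc i) = suc (f i)

module LamT where

  data Tm : Set where
    var  : ℕ → Tm
    lam  : Ty → Tm → Tm
    app  : Tm → Tm → Tm
    zer  : Tm
    suc′ : Tm → Tm
    nrec : Ty → Tm → Tm → Tm → Tm

  num : ℕ → Tm
  num zero    = zer
  num (suc n) = suc′ (num n)

  rename : (ℕ → ℕ) → Tm → Tm
  rename f (var x)        = var (f x)
  rename f (lam ρ t)      = lam ρ (rename (ext f) t)
  rename f (app t s)      = app (rename f t) (rename f s)
  rename f zer            = zer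
  rename f (suc′ t)       = suc′ (rename f t)
  rename f (nrec ρ r s t) = nrec ρ (rename f r) (rename f s) (rename f t)

  exts : (ℕ → Tm) → ℕ → Tm
  exts σ zero    = var zero
  exts σ (suc i) = rename suc (σ i)

  subst : (ℕ → Tm) → Tm → Tm
  subst σ (var x)        = σ x
  subst σ (lam ρ t)      = lam ρ (subst (exts σ) t)
  subst σ (app t s)      = app (subst σ t) (subst σ s)
  subst σ zer            = zer
  subst σ (suc′ t)       = suc′ (subst σ t)
  subst σ (nrec ρ r s t) = nrec ρ (subst σ r) (subst σ s) (subst σ t)

  single : Tm → ℕ → Tm
  single r zero    = r
  single r (suc i) = var i

  _[0:=_] : Tm → Tm → Tm
  t [0:= r ] = subst (single r) t

  infix 4 _⊢_∶_
  data _⊢_∶_ : Ctx → Tm → Ty → Set where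
    ⊢var  : ∀ {Γ x ρ} → Γ ∋ x ∶ ρ → Γ ⊢ var x ∶ ρ
    ⊢lam  : ∀ {Γ ρ σ r} → (ρ ∷ Γ) ⊢ r ∶ σ → Γ ⊢ lam ρ r ∶ ρ ⇒ σ
    ⊢app  : ∀ {Γ σ τ t s} → Γ ⊢ t ∶ σ ⇒ τ → Γ ⊢ s ∶ σ → Γ ⊢ app t s ∶ τ
    ⊢zer  : ∀ {Γ} → Γ ⊢ zer ∶ N
    ⊢suc  : ∀ {Γ t} → Γ ⊢ t ∶ N → Γ ⊢ suc′ t ∶ N
    ⊢nrec : ∀ {Γ ρ r s t} → Γ ⊢ r ∶ ρ → Γ ⊢ s ∶ N ⇒ ρ ⇒ ρ → Γ ⊢ t ∶ N
          → Γ ⊢ nrec ρ r s t ∶ ρ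

  infix 4 _⟶_
  data _⟶_ : Tm → Tm → Set where
    β       : ∀ {ρ t r} → app (lam ρ t) r ⟶ t [0:= r ]
    nrec-0  : ∀ {ρ r s} → nrec ρ r s zer ⟶ r
    nrec-S  : ∀ {ρ r s t} → nrec ρ r s (suc′ t) ⟶ app (app s t) (nrec ρ r s t)
    ξ-lam   : ∀ {ρ t t′} → t ⟶ t′ → lam ρ t ⟶ lam ρ t′
    ξ-appL  : ∀ {t t′ s} → t ⟶ t′ → app t s ⟶ app t′ s
    ξ-appR  : ∀ {t s s′} → s ⟶ s′ → app t s ⟶ app t s′
    ξ-suc   : ∀ {t t′} → t ⟶ t′ → suc′ t ⟶ suc′ t′
    ξ-nrec₁ : ∀ {ρ r r′ s t} → r ⟶ r′ → nrec ρ r s t ⟶ nrec ρ r′ s t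
    ξ-nrec₂ : ∀ {ρ r s s′ t} → s ⟶ s′ → nrec ρ r s t ⟶ nrec ρ r s′ t
    ξ-nrec₃ : ∀ {ρ r s t t′} → t ⟶ t′ → nrec ρ r s t ⟶ nrec ρ r s t′

  infix 4 _≃_
  _≃_ : Tm → Tm → Set
  _≃_ = EqClosure _⟶_

  apps : ∀ {n} → Tm → Vec ℕ n → Tm
  apps t []       = t
  apps t (m ∷ ms) = apps (app t (num m)) ms

module LamMuT where

  mutual
    data Tm : Set where
      var  : ℕ → Tm
      lam  : Ty → Tm → Tm
      app  : Tm → Tm → Tm
      μ    : Ty → Cmd → Tm            -- μ α:ρ. c (binds continuation index 0)
      zer  : Tm
      suc′ : Tm → Tm
      nrec : Ty → Tm → Tm → Tm → Tm

    data Cmd : Set where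
      [_]_ : ℕ → Tm → Cmd

  num : ℕ → Tm
  num zero    = zer
  num (suc n) = suc′ (num n)

  mutual
    rename : (ℕ → ℕ) → Tm → Tm
    rename f (var x)        = var (f x)
    rename f (lam ρ t)      = lam ρ (rename (ext f) t)
    rename f (app t s)      = app (rename f t) (rename f s)
    rename f (μ ρ c)        = μ ρ (renameC f c)
    rename f zer            = zer
    rename f (suc′ t)       = suc′ (rename f t)
    rename f (nrec ρ r s t) = nrec ρ (rename f r) (rename f s) (rename f t)

    renameC : (ℕ → ℕ) → Cmd → Cmd
    renameC f ([ α ] t) = [ α ] rename f t

  mutual
    crename : (ℕ → ℕ) → Tm → Tm
    crename f (var x)        = var x
    crename f (lam ρ t)      = lam ρ (crename f t)
    crename f (app t s)      = app (crename f t) (crename f s)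
    crename f (μ ρ c)        = μ ρ (crenameC (ext f) c)
    crename f zer            = zer
    crename f (suc′ t)       = suc′ (crename f t)
    crename f (nrec ρ r s t) = nrec ρ (crename f r) (crename f s) (crename f t)

    crenameC : (ℕ → ℕ) → Cmd → Cmd
    crenameC f ([ α ] t) = [ f α ] crename f t

  exts : (ℕ → Tm) → ℕ → Tm
  exts σ zero    = var zero
  exts σ (suc i) = rename suc (σ i)

  mutual
    subst : (ℕ → Tm) → Tm → Tm
    subst σ (var x)        = σ x
    subst σ (lam ρ t)      = lam ρ (subst (exts σ) t)
    subst σ (app t s)      = app (subst σ t) (subst σ s)
    subst σ (μ ρ c)        = μ ρ (substC (λ i → crename suc (σ i)) c)
    subst σ zer            = zer
    subst σ (suc′ t)       = suc′ (subst σ t)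
    subst σ (nrec ρ r s t) = nrec ρ (subst σ r) (subst σ s) (subst σ t)

    substC : (ℕ → Tm) → Cmd → Cmd
    substC σ ([ α ] t) = [ α ] subst σ t

  single : Tm → ℕ → Tm
  single r zero    = r
  single r (suc i) = var i

  _[0:=_] : Tm → Tm → Tm
  t [0:= r ] = subst (single r) t

  data ECtx : Set where
    □     : ECtx
    appE  : ECtx → Tm → ECtx
    sucE  : ECtx → ECtx
    nrecE : Ty → Tm → Tm → ECtx → ECtx

  plug : ECtx → Tm → Tm
  plug □               q = q
  plug (appE E t)      q = app (plug E q) t
  plug (sucE E)        q = suc′ (plug E q)
  plug (nrecE ρ r s E) q = nrec ρ r s (plug E q)

  renameE : (ℕ → ℕ) → ECtx → ECtx
  renameE f □               = □
  renameE f (appE E t)      = appE (renameE f E) (rename f t)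
  renameE f (sucE E)        = sucE (renameE f E)
  renameE f (nrecE ρ r s E) = nrecE ρ (rename f r) (rename f s) (renameE f E)

  crenameE : (ℕ → ℕ) → ECtx → ECtx
  crenameE f □               = □
  crenameE f (appE E t)      = appE (crenameE f E) (crename f t)
  crenameE f (sucE E)        = sucE (crenameE f E)
  crenameE f (nrecE ρ r s E) = nrecE ρ (crename f r) (crename f s) (crenameE f E)

  -- structural substitution t[α:=β E]: every subcommand [α]q becomes
  -- [β] E[q[α:=β E]]  (α, β continuation indices in the same context)
  mutual
    ssub : ℕ → ℕ → ECtx → Tm → Tm
    ssub α β E (var x)        = var x
    ssub α β E (lam ρ t)      = lam ρ (ssub α β (renameE suc E) t)
    ssub α β E (app t s)      = app (ssub α β E t) (ssub α β E s)
    ssub α β E (μ ρ c)        = μ ρ (ssubC (suc α) (suc β) (crenameE suc E) c)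
    ssub α β E zer            = zer
    ssub α β E (suc′ t)       = suc′ (ssub α β E t)
    ssub α β E (nrec ρ r s t) = nrec ρ (ssub α β E r) (ssub α β E s) (ssub α β E t)

    ssubC : ℕ → ℕ → ECtx → Cmd → Cmd
    ssubC α β E ([ γ ] q) with γ ≟ α
    ... | yes _ = [ β ] plug E (ssub α β E q)
    ... | no  _ = [ γ ] ssub α β E q

  infix 4 _︔_⊢_∶_ _︔_⊢ᶜ_
  mutual
    data _︔_⊢_∶_ : Ctx → Ctx → Tm → Ty → Set where
      ⊢var  : ∀ {Γ Δ x ρ} → Γ ∋ x ∶ ρ → Γ ︔ Δ ⊢ var x ∶ ρ
      ⊢lam  : ∀ {Γ Δ ρ σ r} → (ρ ∷ Γ) ︔ Δ ⊢ r ∶ σ → Γ ︔ Δ ⊢ lam ρ r ∶ ρ ⇒ σ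
      ⊢app  : ∀ {Γ Δ σ τ t s} → Γ ︔ Δ ⊢ t ∶ σ ⇒ τ → Γ ︔ Δ ⊢ s ∶ σ
            → Γ ︔ Δ ⊢ app t s ∶ τ
      ⊢μ    : ∀ {Γ Δ ρ c} → Γ ︔ (ρ ∷ Δ) ⊢ᶜ c → Γ ︔ Δ ⊢ μ ρ c ∶ ρ
      ⊢zer  : ∀ {Γ Δ} → Γ ︔ Δ ⊢ zer ∶ N
      ⊢suc  : ∀ {Γ Δ t} → Γ ︔ Δ ⊢ t ∶ N → Γ ︔ Δ ⊢ suc′ t ∶ N
      ⊢nrec : ∀ {Γ Δ ρ r s t} → Γ ︔ Δ ⊢ r ∶ ρ → Γ ︔ Δ ⊢ s ∶ N ⇒ ρ ⇒ ρ
            → Γ ︔ Δ ⊢ t ∶ N → Γ ︔ Δ ⊢ nrec ρ r s t ∶ ρ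

    data _︔_⊢ᶜ_ : Ctx → Ctx → Cmd → Set where
      ⊢cmd : ∀ {Γ Δ α ρ t} → Γ ︔ Δ ⊢ t ∶ ρ → Δ ∋ α ∶ ρ → Γ ︔ Δ ⊢ᶜ [ α ] t

  infix 4 _⟶_ _⟶ᶜ_
  mutual
    data _⟶_ : Tm → Tm → Set where
      β       : ∀ {ρ t r} → app (lam ρ t) r ⟶ t [0:= r ]
      μ-S     : ∀ {ρ c} → suc′ (μ ρ c) ⟶ μ ρ (ssubC 0 0 (sucE □) c)
      μ-app   : ∀ {ρ c s} → app (μ ρ c) s ⟶ μ ρ (ssubC 0 0 (appE □ (crename suc s)) c)
      -- μα.[α]t → t  when α ∉ FCV(t): the body is t shifted past α
      μ-η     : ∀ {ρ t} → μ ρ ([ 0 ] crename suc t) ⟶ t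
      nrec-0  : ∀ {ρ r s} → nrec ρ r s zer ⟶ r
      nrec-S  : ∀ {ρ r s n} → nrec ρ r s (suc′ (num n))
                ⟶ app (app s (num n)) (nrec ρ r s (num n))
      nrec-μ  : ∀ {ρ σ r s c} → nrec ρ r s (μ σ c)
                ⟶ μ σ (ssubC 0 0 (nrecE ρ (crename suc r) (crename suc s) □) c)
      ξ-lam   : ∀ {ρ t t′} → t ⟶ t′ → lam ρ t ⟶ lam ρ t′
      ξ-appL  : ∀ {t t′ s} → t ⟶ t′ → app t s ⟶ app t′ s
      ξ-appR  : ∀ {t s s′} → s ⟶ s′ → app t s ⟶ app t s′
      ξ-μ     : ∀ {ρ c c′} → c ⟶ᶜ c′ → μ ρ c ⟶ μ ρ c′
      ξ-suc   : ∀ {t t′} → t ⟶ t′ → suc′ t ⟶ suc′ t′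
      ξ-nrec₁ : ∀ {ρ r r′ s t} → r ⟶ r′ → nrec ρ r s t ⟶ nrec ρ r′ s t
      ξ-nrec₂ : ∀ {ρ r s s′ t} → s ⟶ s′ → nrec ρ r s t ⟶ nrec ρ r s′ t
      ξ-nrec₃ : ∀ {ρ r s t t′} → t ⟶ t′ → nrec ρ r s t ⟶ nrec ρ r s t′

    data _⟶ᶜ_ : Cmd → Cmd → Set where
      -- [α]μβ.c → c[β:=α□]; afterwards index 0 (β) no longer occurs and
      -- the remaining continuation indices are shifted down by one
      μ-cmd : ∀ {α ρ c} → [ α ] μ ρ c ⟶ᶜ crenameC pred (ssubC 0 (suc α) □ c)
      ξ-cmd : ∀ {α t t′} → t ⟶ t′ → [ α ] t ⟶ᶜ [ α ] t′

  infix 4 _≃_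
  _≃_ : Tm → Tm → Set
  _≃_ = EqClosure _⟶_

  apps : ∀ {n} → Tm → Vec ℕ n → Tm
  apps t []       = t
  apps t (m ∷ ms) = apps (app t (num m)) ms

module Submission where

-- Proof: a call-by-name CPS translation  cps  maps λμT into λT.  A term
-- of type ρ becomes a computation of type Comp ρ = Cont ρ ⇒ ℕ; μα.c binds
-- the current continuation to α, and [α]t runs t with that continuation.
--  1. Substitution, Conversion, Confluence: metatheory of λT, including
--     Church–Rosser and the fact that numerals are normal forms.
--  2. CPS, CPS-Conversion: the translation on type-erased λT-terms; a
--     structural substitution t[α:=βE] is matched by rebinding α to the
--     continuation denoted by the evaluation context E.
--  3. Simulation: t ⟶ t′ in λμT implies cps t ≃ cps t′ in λT.
--  4. Readback: if t computes f then so does  readback n (cps t), which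
--     feeds numerals and the identity continuation to cps t (erased terms).
--  5. Erasure: a λT-term whose erasure converts to a numeral converts to
--     that numeral itself, since reductions lift along erasure.
--  6. TypedCPS: a typing derivation of t yields a well-typed λT-term that
--     erases to cps t; the same holds for the readback.

open import Defs
open import Data.Nat using (ℕ)
open import Data.List using ([])
open import Data.Vec using (Vec)
open import Data.Product using (Σ; _×_; _,_)
open import Relation.Binary.PropositionalEquality using (_≡_; trans; cong)

-- Renaming and substitution in λT

module Substitution where

  open import Data.Nat using (zero; suc)
  open import Relation.Binary.PropositionalEquality
    using (_≡_; refl; sym; trans; cong; cong₂)
  open LamT

  cong₃ : ∀ {A B C D : Set} (f : A → B → C → D) {a a′ b b′ c c′}
        → a ≡ a′ → b ≡ b′ → c ≡ c′ → f a b c ≡ f a′ b′ c′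
  cong₃ f refl refl refl = refl

  w : Tm → Tm
  w = rename suc

  exts-cong : ∀ {σ τ : ℕ → Tm} → (∀ x → σ x ≡ τ x) → ∀ x → exts σ x ≡ exts τ x
  exts-cong h zero    = refl
  exts-cong h (suc x) = cong w (h x)

  sub-cong : ∀ {σ τ : ℕ → Tm} → (∀ x → σ x ≡ τ x) → ∀ t → subst σ t ≡ subst τ t
  sub-cong h (var x)        = h x
  sub-cong h (lam ρ t)      = cong (lam ρ) (sub-cong (exts-cong h) t)
  sub-cong h (app t s)      = cong₂ app (sub-cong h t) (sub-cong h s)
  sub-cong h zer            = refl
  sub-cong h (suc′ t)       = cong suc′ (sub-cong h t)
  sub-cong h (nrec ρ r s t) = cong₃ (nrec ρ) (sub-cong h r) (sub-cong h s) (sub-cong h t)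

  ren≡sub : ∀ (f : ℕ → ℕ) t → rename f t ≡ subst (λ x → var (f x)) t
  ren≡sub f (var x)        = refl
  ren≡sub f (lam ρ t)      = cong (lam ρ) (trans (ren≡sub (ext f) t) (sub-cong ext-var t))
    where ext-var : ∀ x → var (ext f x) ≡ exts (λ x → var (f x)) x
          ext-var zero    = refl
          ext-var (suc x) = refl
  ren≡sub f (app t s)      = cong₂ app (ren≡sub f t) (ren≡sub f s)
  ren≡sub f zer            = refl
  ren≡sub f (suc′ t)       = cong suc′ (ren≡sub f t)
  ren≡sub f (nrec ρ r s t) = cong₃ (nrec ρ) (ren≡sub f r) (ren≡sub f s) (ren≡sub f t)

  ren-ren : ∀ {f g h : ℕ → ℕ} → (∀ x → f (g x) ≡ h x)
          → ∀ t → rename f (rename g t) ≡ rename h t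
  ren-ren e (var x)        = cong var (e x)
  ren-ren {f} {g} {h} e (lam ρ t) = cong (lam ρ) (ren-ren e′ t)
    where e′ : ∀ x → ext f (ext g x) ≡ ext h x
          e′ zero    = refl
          e′ (suc x) = cong suc (e x)
  ren-ren e (app t s)      = cong₂ app (ren-ren e t) (ren-ren e s)
  ren-ren e zer            = refl
  ren-ren e (suc′ t)       = cong suc′ (ren-ren e t)
  ren-ren e (nrec ρ r s t) = cong₃ (nrec ρ) (ren-ren e r) (ren-ren e s) (ren-ren e t)

  ext-w : ∀ f t → rename (ext f) (w t) ≡ w (rename f t)
  ext-w f t = trans (ren-ren (λ _ → refl) t) (sym (ren-ren (λ _ → refl) t))

  ren-sub : ∀ {f : ℕ → ℕ} {σ τ} → (∀ x → rename f (σ x) ≡ τ x)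
          → ∀ t → rename f (subst σ t) ≡ subst τ t
  ren-sub e (var x)        = e x
  ren-sub {f} {σ} {τ} e (lam ρ t) = cong (lam ρ) (ren-sub e′ t)
    where e′ : ∀ x → rename (ext f) (exts σ x) ≡ exts τ x
          e′ zero    = refl
          e′ (suc x) = trans (ext-w f (σ x)) (cong w (e x))
  ren-sub e (app t s)      = cong₂ app (ren-sub e t) (ren-sub e s)
  ren-sub e zer            = refl
  ren-sub e (suc′ t)       = cong suc′ (ren-sub e t)
  ren-sub e (nrec ρ r s t) = cong₃ (nrec ρ) (ren-sub e r) (ren-sub e s) (ren-sub e t)

  sub-ren : ∀ {f : ℕ → ℕ} {σ τ} → (∀ x → σ (f x) ≡ τ x)
          → ∀ t → subst σ (rename f t) ≡ subst τ t
  sub-ren e (var x)        = e x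
  sub-ren {f} {σ} {τ} e (lam ρ t) = cong (lam ρ) (sub-ren e′ t)
    where e′ : ∀ x → exts σ (ext f x) ≡ exts τ x
          e′ zero    = refl
          e′ (suc x) = cong w (e x)
  sub-ren e (app t s)      = cong₂ app (sub-ren e t) (sub-ren e s)
  sub-ren e zer            = refl
  sub-ren e (suc′ t)       = cong suc′ (sub-ren e t)
  sub-ren e (nrec ρ r s t) = cong₃ (nrec ρ) (sub-ren e r) (sub-ren e s) (sub-ren e t)

  sub-w : ∀ σ t → subst (exts σ) (w t) ≡ w (subst σ t)
  sub-w σ t = trans (sub-ren (λ _ → refl) t) (sym (ren-sub (λ _ → refl) t))

  sub-sub : ∀ {σ τ υ} → (∀ x → subst τ (σ x) ≡ υ x)
          → ∀ t → subst τ (subst σ t) ≡ subst υ t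
  sub-sub e (var x)        = e x
  sub-sub {σ} {τ} {υ} e (lam ρ t) = cong (lam ρ) (sub-sub e′ t)
    where e′ : ∀ x → subst (exts τ) (exts σ x) ≡ exts υ x
          e′ zero    = refl
          e′ (suc x) = trans (sub-w τ (σ x)) (cong w (e x))
  sub-sub e (app t s)      = cong₂ app (sub-sub e t) (sub-sub e s)
  sub-sub e zer            = refl
  sub-sub e (suc′ t)       = cong suc′ (sub-sub e t)
  sub-sub e (nrec ρ r s t) = cong₃ (nrec ρ) (sub-sub e r) (sub-sub e s) (sub-sub e t)

  sub-id : ∀ {σ} → (∀ x → σ x ≡ var x) → ∀ t → subst σ t ≡ t
  sub-id e (var x)        = e x
  sub-id {σ} e (lam ρ t)  = cong (lam ρ) (sub-id e′ t)
    where e′ : ∀ x → exts σ x ≡ var x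
          e′ zero    = refl
          e′ (suc x) = cong w (e x)
  sub-id e (app t s)      = cong₂ app (sub-id e t) (sub-id e s)
  sub-id e zer            = refl
  sub-id e (suc′ t)       = cong suc′ (sub-id e t)
  sub-id e (nrec ρ r s t) = cong₃ (nrec ρ) (sub-id e r) (sub-id e s) (sub-id e t)

  w-[0:=] : ∀ r t → w t [0:= r ] ≡ t
  w-[0:=] r t = trans (sub-ren (λ _ → refl) t) (sub-id (λ _ → refl) t)

  sub-[0:=] : ∀ σ t r → subst σ (t [0:= r ]) ≡ subst (exts σ) t [0:= subst σ r ]
  sub-[0:=] σ t r = trans (sub-sub (λ _ → refl) t) (sym (sub-sub e t))
    where e : ∀ x → subst (single (subst σ r)) (exts σ x) ≡ subst σ (single r x)
          e zero    = refl
          e (suc x) = w-[0:=] _ (σ x)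

  num-ren : ∀ f n → rename f (num n) ≡ num n
  num-ren f zero    = refl
  num-ren f (suc n) = cong suc′ (num-ren f n)

-- Conversion in λT: closure under substitution, congruences, reasoning

module Conversion where

  open import Data.Nat using (suc)
  open import Relation.Binary.PropositionalEquality
    using (_≡_; refl; sym; cong) renaming (subst to transport)
  open import Relation.Binary.Construct.Closure.Equivalence
    using (gmap; symmetric; transitive; return)
  open import Relation.Binary.Construct.Closure.ReflexiveTransitive using (ε)
  open LamT
  open Substitution

  sub-⟶ : ∀ σ {t t′} → t ⟶ t′ → subst σ t ⟶ subst σ t′
  sub-⟶ σ (β {ρ} {t} {r}) =
    transport (app (lam ρ (subst (exts σ) t)) (subst σ r) ⟶_) (sym (sub-[0:=] σ t r)) β
  sub-⟶ σ nrec-0      = nrec-0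
  sub-⟶ σ nrec-S      = nrec-S
  sub-⟶ σ (ξ-lam s)   = ξ-lam (sub-⟶ (exts σ) s)
  sub-⟶ σ (ξ-appL s)  = ξ-appL (sub-⟶ σ s)
  sub-⟶ σ (ξ-appR s)  = ξ-appR (sub-⟶ σ s)
  sub-⟶ σ (ξ-suc s)   = ξ-suc (sub-⟶ σ s)
  sub-⟶ σ (ξ-nrec₁ s) = ξ-nrec₁ (sub-⟶ σ s)
  sub-⟶ σ (ξ-nrec₂ s) = ξ-nrec₂ (sub-⟶ σ s)
  sub-⟶ σ (ξ-nrec₃ s) = ξ-nrec₃ (sub-⟶ σ s)

  ≃refl : ∀ {a} → a ≃ a
  ≃refl = ε

  ≃sym : ∀ {a b} → a ≃ b → b ≃ a
  ≃sym = symmetric _⟶_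

  ≃trans : ∀ {a b c} → a ≃ b → b ≃ c → a ≃ c
  ≃trans = transitive _⟶_

  ⟶≃ : ∀ {a b} → a ⟶ b → a ≃ b
  ⟶≃ = return

  ≡≃ : ∀ {a b} → a ≡ b → a ≃ b
  ≡≃ refl = ε

  module ≃-Reasoning where
    open import Relation.Binary.Reasoning.Base.Single _≃_ ≃refl ≃trans public
      hiding (step-∼) renaming (∼-go to ≃-go)
    open import Relation.Binary.Reasoning.Syntax using (module ≃-syntax; module ⟶-syntax)
    open ≃-syntax _IsRelatedTo_ _IsRelatedTo_ ≃-go ≃sym public
    open ⟶-syntax _IsRelatedTo_ _IsRelatedTo_ (λ st → ≃-go (⟶≃ st)) public

  sub-≃ : ∀ σ {a b} → a ≃ b → subst σ a ≃ subst σ b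
  sub-≃ σ = gmap (subst σ) (sub-⟶ σ)

  ren-≃ : ∀ f {a b} → a ≃ b → rename f a ≃ rename f b
  ren-≃ f {a} {b} e =
    ≃trans (≡≃ (ren≡sub f a)) (≃trans (sub-≃ _ e) (≡≃ (sym (ren≡sub f b))))

  w-≃ : ∀ {a b} → a ≃ b → w a ≃ w b
  w-≃ = ren-≃ suc

  lam-≃ : ∀ {ρ a b} → a ≃ b → lam ρ a ≃ lam ρ b
  lam-≃ = gmap _ ξ-lam

  app-≃ : ∀ {a b c d} → a ≃ b → c ≃ d → app a c ≃ app b d
  app-≃ e₁ e₂ = ≃trans (gmap (λ z → app z _) ξ-appL e₁) (gmap _ ξ-appR e₂)

  appˡ-≃ : ∀ {a b c} → a ≃ b → app a c ≃ app b c
  appˡ-≃ e = app-≃ e ≃refl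

  appʳ-≃ : ∀ {a c d} → c ≃ d → app a c ≃ app a d
  appʳ-≃ = app-≃ ≃refl

  nrec-≃ : ∀ {ρ a b c d e f} → a ≃ b → c ≃ d → e ≃ f → nrec ρ a c e ≃ nrec ρ b d f
  nrec-≃ e₁ e₂ e₃ = ≃trans (gmap (λ z → nrec _ z _ _) ξ-nrec₁ e₁)
    (≃trans (gmap (λ z → nrec _ _ z _) ξ-nrec₂ e₂) (gmap _ ξ-nrec₃ e₃))

-- Church–Rosser for λT, by Tait–Martin-Löf parallel reduction and
-- Takahashi's complete developments; and numerals are normal forms.

module Confluence where

  open import Data.Nat using (zero; suc)
  open import Data.Product using (_,_)
  open import Data.Empty using (⊥; ⊥-elim)
  open import Relation.Binary.PropositionalEquality
    using (_≡_; refl; sym; trans; cong₂) renaming (subst to transport)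
  open import Relation.Binary.Construct.Closure.ReflexiveTransitive
    using (Star; ε; _◅_; _◅◅_; gmap) renaming (map to map*)
  open import Relation.Binary.Construct.Closure.Symmetric using (fwd; bwd)
  open LamT
  open Substitution

  infix 4 _⇛_ _⟶*_ _⇛*_

  _⟶*_ : Tm → Tm → Set
  _⟶*_ = Star _⟶_

  data _⇛_ : Tm → Tm → Set where
    pvar   : ∀ {x} → var x ⇛ var x
    plam   : ∀ {ρ t t′} → t ⇛ t′ → lam ρ t ⇛ lam ρ t′
    papp   : ∀ {t t′ s s′} → t ⇛ t′ → s ⇛ s′ → app t s ⇛ app t′ s′
    pβ     : ∀ {ρ t t′ s s′} → t ⇛ t′ → s ⇛ s′ → app (lam ρ t) s ⇛ t′ [0:= s′ ]
    pzer   : zer ⇛ zer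
    psuc   : ∀ {t t′} → t ⇛ t′ → suc′ t ⇛ suc′ t′
    pnrec  : ∀ {ρ r r′ s s′ t t′} → r ⇛ r′ → s ⇛ s′ → t ⇛ t′
           → nrec ρ r s t ⇛ nrec ρ r′ s′ t′
    pnrec0 : ∀ {ρ r r′ s} → r ⇛ r′ → nrec ρ r s zer ⇛ r′
    pnrecS : ∀ {ρ r r′ s s′ t t′} → r ⇛ r′ → s ⇛ s′ → t ⇛ t′
           → nrec ρ r s (suc′ t) ⇛ app (app s′ t′) (nrec ρ r′ s′ t′)

  _⇛*_ : Tm → Tm → Set
  _⇛*_ = Star _⇛_

  ⇛-refl : ∀ t → t ⇛ t
  ⇛-refl (var x)        = pvar
  ⇛-refl (lam ρ t)      = plam (⇛-refl t)
  ⇛-refl (app t s)      = papp (⇛-refl t) (⇛-refl s)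
  ⇛-refl zer            = pzer
  ⇛-refl (suc′ t)       = psuc (⇛-refl t)
  ⇛-refl (nrec ρ r s t) = pnrec (⇛-refl r) (⇛-refl s) (⇛-refl t)

  ren-[0:=] : ∀ f t r → rename f (t [0:= r ]) ≡ rename (ext f) t [0:= rename f r ]
  ren-[0:=] f t r = trans (ren≡sub f _) (trans (sub-[0:=] _ t r)
    (cong₂ _[0:=_] (trans (sub-cong ext-var t) (sym (ren≡sub (ext f) t))) (sym (ren≡sub f r))))
    where ext-var : ∀ x → exts (λ x → var (f x)) x ≡ var (ext f x)
          ext-var zero    = refl
          ext-var (suc x) = refl

  ⇛-ren : ∀ f {t t′} → t ⇛ t′ → rename f t ⇛ rename f t′
  ⇛-ren f pvar           = pvar
  ⇛-ren f (plam p)       = plam (⇛-ren (ext f) p)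
  ⇛-ren f (papp p q)     = papp (⇛-ren f p) (⇛-ren f q)
  ⇛-ren f (pβ {t′ = t′} {s′ = s′} p q) =
    transport (_ ⇛_) (sym (ren-[0:=] f t′ s′)) (pβ (⇛-ren (ext f) p) (⇛-ren f q))
  ⇛-ren f pzer           = pzer
  ⇛-ren f (psuc p)       = psuc (⇛-ren f p)
  ⇛-ren f (pnrec p q r)  = pnrec (⇛-ren f p) (⇛-ren f q) (⇛-ren f r)
  ⇛-ren f (pnrec0 p)     = pnrec0 (⇛-ren f p)
  ⇛-ren f (pnrecS p q r) = pnrecS (⇛-ren f p) (⇛-ren f q) (⇛-ren f r)

  ⇛-exts : ∀ {σ τ} → (∀ x → σ x ⇛ τ x) → ∀ x → exts σ x ⇛ exts τ x
  ⇛-exts h zero    = pvar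
  ⇛-exts h (suc x) = ⇛-ren suc (h x)

  ⇛-sub : ∀ {σ τ} → (∀ x → σ x ⇛ τ x) → ∀ {t t′} → t ⇛ t′ → subst σ t ⇛ subst τ t′
  ⇛-sub h pvar           = h _
  ⇛-sub h (plam p)       = plam (⇛-sub (⇛-exts h) p)
  ⇛-sub h (papp p q)     = papp (⇛-sub h p) (⇛-sub h q)
  ⇛-sub {τ = τ} h (pβ {t′ = t′} {s′ = s′} p q) =
    transport (_ ⇛_) (sym (sub-[0:=] τ t′ s′)) (pβ (⇛-sub (⇛-exts h) p) (⇛-sub h q))
  ⇛-sub h pzer           = pzer
  ⇛-sub h (psuc p)       = psuc (⇛-sub h p)
  ⇛-sub h (pnrec p q r)  = pnrec (⇛-sub h p) (⇛-sub h q) (⇛-sub h r)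
  ⇛-sub h (pnrec0 p)     = pnrec0 (⇛-sub h p)
  ⇛-sub h (pnrecS p q r) = pnrecS (⇛-sub h p) (⇛-sub h q) (⇛-sub h r)

  ⇛-[0:=] : ∀ {t t′ s s′} → t ⇛ t′ → s ⇛ s′ → t [0:= s ] ⇛ t′ [0:= s′ ]
  ⇛-[0:=] {s = s} {s′ = s′} p q = ⇛-sub single-⇛ p
    where single-⇛ : ∀ x → single s x ⇛ single s′ x
          single-⇛ zero    = q
          single-⇛ (suc x) = pvar

  cd : Tm → Tm
  cd (var x)               = var x
  cd (lam ρ t)             = lam ρ (cd t)
  cd (app (lam ρ t) s)     = cd t [0:= cd s ]
  cd (app t s)             = app (cd t) (cd s)
  cd zer                   = zer
  cd (suc′ t)              = suc′ (cd t)
  cd (nrec ρ r s zer)      = cd r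
  cd (nrec ρ r s (suc′ t)) = app (app (cd s) (cd t)) (nrec ρ (cd r) (cd s) (cd t))
  cd (nrec ρ r s t)        = nrec ρ (cd r) (cd s) (cd t)

  triangle : ∀ {t u} → t ⇛ u → u ⇛ cd t
  triangle pvar                                 = pvar
  triangle (plam p)                             = plam (triangle p)
  triangle (papp {t = lam ρ t} (plam p) q)      = pβ (triangle p) (triangle q)
  triangle (papp {t = var x} p q)               = papp (triangle p) (triangle q)
  triangle (papp {t = app _ _} p q)             = papp (triangle p) (triangle q)
  triangle (papp {t = zer} p q)                 = papp (triangle p) (triangle q)
  triangle (papp {t = suc′ _} p q)              = papp (triangle p) (triangle q)
  triangle (papp {t = nrec _ _ _ _} p q)        = papp (triangle p) (triangle q)
  triangle (pβ p q)                             = ⇛-[0:=] (triangle p) (triangle q)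
  triangle pzer                                 = pzer
  triangle (psuc p)                             = psuc (triangle p)
  triangle (pnrec {t = zer} p q pzer)           = pnrec0 (triangle p)
  triangle (pnrec {t = suc′ _} p q (psuc r))    = pnrecS (triangle p) (triangle q) (triangle r)
  triangle (pnrec {t = var _} p q r)            = pnrec (triangle p) (triangle q) (triangle r)
  triangle (pnrec {t = lam _ _} p q r)          = pnrec (triangle p) (triangle q) (triangle r)
  triangle (pnrec {t = app _ _} p q r)          = pnrec (triangle p) (triangle q) (triangle r)
  triangle (pnrec {t = nrec _ _ _ _} p q r)     = pnrec (triangle p) (triangle q) (triangle r)
  triangle (pnrec0 p)                           = triangle p
  triangle (pnrecS p q r) =
    papp (papp (triangle q) (triangle r)) (pnrec (triangle p) (triangle q) (triangle r))

  strip⇛ : ∀ {a b c} → a ⇛ b → a ⇛* c → Σ Tm (λ d → (c ⇛ d) × (b ⇛* d))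
  strip⇛ {b = b} p ε = b , p , ε
  strip⇛ p (q ◅ qs) with strip⇛ (triangle q) qs
  ... | d , c⇛d , cd⇛*d = d , c⇛d , (triangle p ◅ cd⇛*d)

  ⟶⇛ : ∀ {a b} → a ⟶ b → a ⇛ b
  ⟶⇛ (β {t = t} {r = r})                  = pβ (⇛-refl t) (⇛-refl r)
  ⟶⇛ (nrec-0 {r = r})                     = pnrec0 (⇛-refl r)
  ⟶⇛ (nrec-S {r = r} {s = s} {t = t})     = pnrecS (⇛-refl r) (⇛-refl s) (⇛-refl t)
  ⟶⇛ (ξ-lam p)                            = plam (⟶⇛ p)
  ⟶⇛ (ξ-appL {s = s} p)                   = papp (⟶⇛ p) (⇛-refl s)
  ⟶⇛ (ξ-appR {t = t} p)                   = papp (⇛-refl t) (⟶⇛ p)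
  ⟶⇛ (ξ-suc p)                            = psuc (⟶⇛ p)
  ⟶⇛ (ξ-nrec₁ {s = s} {t = t} p)          = pnrec (⟶⇛ p) (⇛-refl s) (⇛-refl t)
  ⟶⇛ (ξ-nrec₂ {r = r} {t = t} p)          = pnrec (⇛-refl r) (⟶⇛ p) (⇛-refl t)
  ⟶⇛ (ξ-nrec₃ {r = r} {s = s} p)          = pnrec (⇛-refl r) (⇛-refl s) (⟶⇛ p)

  ⇛⟶* : ∀ {a b} → a ⇛ b → a ⟶* b
  ⇛⟶* pvar           = ε
  ⇛⟶* (plam p)       = gmap _ ξ-lam (⇛⟶* p)
  ⇛⟶* (papp p q)     = gmap (λ z → app z _) ξ-appL (⇛⟶* p) ◅◅ gmap _ ξ-appR (⇛⟶* q)
  ⇛⟶* (pβ p q)       =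
    gmap (λ z → app (lam _ z) _) (λ s → ξ-appL (ξ-lam s)) (⇛⟶* p)
    ◅◅ gmap _ ξ-appR (⇛⟶* q) ◅◅ β ◅ ε
  ⇛⟶* pzer           = ε
  ⇛⟶* (psuc p)       = gmap _ ξ-suc (⇛⟶* p)
  ⇛⟶* (pnrec p q r)  =
    gmap (λ z → nrec _ z _ _) ξ-nrec₁ (⇛⟶* p)
    ◅◅ gmap (λ z → nrec _ _ z _) ξ-nrec₂ (⇛⟶* q) ◅◅ gmap _ ξ-nrec₃ (⇛⟶* r)
  ⇛⟶* (pnrec0 p)     = nrec-0 ◅ ⇛⟶* p
  ⇛⟶* (pnrecS p q r) =
    nrec-S ◅ gmap (λ z → app (app z _) _) (λ s → ξ-appL (ξ-appL s)) (⇛⟶* q)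
    ◅◅ gmap (λ z → app (app _ z) _) (λ s → ξ-appL (ξ-appR s)) (⇛⟶* r)
    ◅◅ gmap (app _) ξ-appR (⇛⟶* (pnrec p q r))

  ⇛*⟶* : ∀ {a b} → a ⇛* b → a ⟶* b
  ⇛*⟶* ε        = ε
  ⇛*⟶* (p ◅ ps) = ⇛⟶* p ◅◅ ⇛*⟶* ps

  strip : ∀ {a b c} → a ⟶ b → a ⟶* c → Σ Tm (λ d → (b ⟶* d) × (c ⟶* d))
  strip st r with strip⇛ (⟶⇛ st) (map* ⟶⇛ r)
  ... | d , c⇛d , b⇛*d = d , ⇛*⟶* b⇛*d , ⇛⟶* c⇛d

  church-rosser : ∀ {a b} → a ≃ b → Σ Tm (λ c → (a ⟶* c) × (b ⟶* c))
  church-rosser {a} ε = a , ε , ε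
  church-rosser (fwd st ◅ rest) with church-rosser rest
  ... | c , b⟶*c , b′⟶*c = c , st ◅ b⟶*c , b′⟶*c
  church-rosser (bwd st ◅ rest) with church-rosser rest
  ... | c , b⟶*c , b′⟶*c with strip st b⟶*c
  ... | e , a⟶*e , c⟶*e = e , a⟶*e , b′⟶*c ◅◅ c⟶*e

  num-normal : ∀ k {v} → num k ⟶ v → ⊥
  num-normal zero    ()
  num-normal (suc k) (ξ-suc st) = num-normal k st

  num-normal* : ∀ k {v} → num k ⟶* v → v ≡ num k
  num-normal* k ε          = refl
  num-normal* k (st ◅ _)   = ⊥-elim (num-normal k st)

  ⟶*≃ : ∀ {a b} → a ⟶* b → a ≃ b
  ⟶*≃ = map* fwd

-- The CPS translation of λμT into (type-erased) λT
--
-- A term of type ρ becomes a function of its continuation.  Values of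
-- type ℕ are numerals; a value of type σ ⇒ τ is a function from
-- translated arguments to translated results.  The translation is
-- parametrised by an environment φ for the term variables (translated
-- terms) and ψ for the continuation variables (continuations).

module CPS where

  open import Data.Nat using (zero; suc)
  open import Relation.Binary.PropositionalEquality
    using (_≡_; refl; sym; trans; cong; cong₂)
  module S = LamMuT
  open LamT
  open Substitution

  -- all binders of erased terms carry the annotation ℕ
  L : Tm → Tm
  L = lam N

  infixr 5 _∷ₑ_
  _∷ₑ_ : Tm → (ℕ → Tm) → ℕ → Tm
  (a ∷ₑ φ) zero    = a
  (a ∷ₑ φ) (suc i) = φ i

  wₑ : (ℕ → Tm) → ℕ → Tm
  wₑ φ i = w (φ i)

  ret : Tm → Tm
  ret V = L (app (var 0) (w V))

  η : Tm → Tm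
  η X = L (app (w X) (var 0))

  argK : Tm → Tm → Tm
  argK Y K = L (app (app (var 0) (w Y)) (w K))

  sucK : Tm → Tm
  sucK K = L (app (w K) (suc′ (var 0)))

  -- in the context n, y, k: the continuation  λf. f (λk′. k′ n) (λg. g (λk′. y k′) k)
  -- that passes the predecessor n and the recursive result y to a step function
  stepK : Tm
  stepK = argK (ret (var 2)) (argK (η (var 1)) (var 0))

  stepCPS : Tm → Tm
  stepCPS X = L (L (L (app (w (w (w X))) stepK)))

  nrecK : Tm → Tm → Tm → Tm
  nrecK R X K = L (app (nrec N (w R) (w (stepCPS X)) (var 0)) (w K))

  -- environments under the two binders  λk. k (λx. ⋯)  of a translated λ;
  -- the bound variable x is used in the η-expanded form  λk. x k
  lamEnv : (ℕ → Tm) → ℕ → Tm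
  lamEnv φ = η (var 0) ∷ₑ wₑ (wₑ φ)

  μEnv : (ℕ → Tm) → ℕ → Tm
  μEnv ψ = var 0 ∷ₑ wₑ ψ

  mutual
    cps : (ℕ → Tm) → (ℕ → Tm) → S.Tm → Tm
    cps φ ψ (S.var x)        = φ x
    cps φ ψ (S.lam ρ r)      = L (app (var 0) (L (cps (lamEnv φ) (wₑ (wₑ ψ)) r)))
    cps φ ψ (S.app t s)      = L (app (w (cps φ ψ t)) (argK (w (cps φ ψ s)) (var 0)))
    cps φ ψ (S.μ ρ c)        = L (cpsᶜ (wₑ φ) (μEnv ψ) c)
    cps φ ψ S.zer            = L (app (var 0) zer)
    cps φ ψ (S.suc′ t)       = L (app (w (cps φ ψ t)) (sucK (var 0)))
    cps φ ψ (S.nrec ρ r s t) =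
      L (app (w (cps φ ψ t)) (nrecK (w (cps φ ψ r)) (w (cps φ ψ s)) (var 0)))

    cpsᶜ : (ℕ → Tm) → (ℕ → Tm) → S.Cmd → Tm
    cpsᶜ φ ψ (S.[ α ] t) = app (cps φ ψ t) (ψ α)

  sub-ww : ∀ σ X → subst (exts (exts σ)) (w (w X)) ≡ w (w (subst σ X))
  sub-ww σ X = trans (sub-w (exts σ) (w X)) (cong w (sub-w σ X))

  sub-stepCPS : ∀ σ X → subst σ (stepCPS X) ≡ stepCPS (subst σ X)
  sub-stepCPS σ X = cong (λ z → L (L (L (app z stepK))))
    (trans (sub-w (exts (exts σ)) (w (w X))) (cong w (sub-ww σ X)))

  sub-argK : ∀ σ Y K → subst σ (argK Y K) ≡ argK (subst σ Y) (subst σ K)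
  sub-argK σ Y K = cong₂ (λ a b → L (app (app (var 0) a) b)) (sub-w σ Y) (sub-w σ K)

  sub-ret : ∀ σ V → subst σ (ret V) ≡ ret (subst σ V)
  sub-ret σ V = cong (λ z → L (app (var 0) z)) (sub-w σ V)

  sub-η : ∀ σ X → subst σ (η X) ≡ η (subst σ X)
  sub-η σ X = cong (λ z → L (app z (var 0))) (sub-w σ X)

  w-ret : ∀ V → w (ret V) ≡ ret (w V)
  w-ret V = cong (λ z → L (app (var 0) z)) (ext-w suc V)

  w-η : ∀ X → w (η X) ≡ η (w X)
  w-η X = cong (λ z → L (app z (var 0))) (ext-w suc X)

  w-ret-num : ∀ n → w (ret (num n)) ≡ ret (num n)
  w-ret-num n = trans (w-ret (num n)) (cong ret (num-ren suc n))

  sub-sucK : ∀ σ K → subst σ (sucK K) ≡ sucK (subst σ K)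
  sub-sucK σ K = cong (λ a → L (app a (suc′ (var 0)))) (sub-w σ K)

  sub-nrecK : ∀ σ R X K → subst σ (nrecK R X K) ≡ nrecK (subst σ R) (subst σ X) (subst σ K)
  sub-nrecK σ R X K = cong₃ (λ a b c → L (app (nrec N a b (var 0)) c)) (sub-w σ R)
    (trans (sub-w σ (stepCPS X)) (cong w (sub-stepCPS σ X))) (sub-w σ K)

  mutual
    sub-cps : ∀ σ {φ φ′ ψ ψ′} → (∀ i → subst σ (φ i) ≡ φ′ i) → (∀ i → subst σ (ψ i) ≡ ψ′ i)
            → ∀ t → subst σ (cps φ ψ t) ≡ cps φ′ ψ′ t
    sub-cps σ hφ hψ (S.var x) = hφ x
    sub-cps σ {φ} {φ′} {ψ} {ψ′} hφ hψ (S.lam ρ r) =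
      cong (λ z → L (app (var 0) (L z))) (sub-cps (exts (exts σ)) hφ′ hψ′ r)
      where hφ′ : ∀ i → subst (exts (exts σ)) (lamEnv φ i) ≡ lamEnv φ′ i
            hφ′ zero    = refl
            hφ′ (suc i) = trans (sub-ww σ (φ i)) (cong (λ z → w (w z)) (hφ i))
            hψ′ : ∀ i → subst (exts (exts σ)) (w (w (ψ i))) ≡ w (w (ψ′ i))
            hψ′ i = trans (sub-ww σ (ψ i)) (cong (λ z → w (w z)) (hψ i))
    sub-cps σ {φ} {ψ = ψ} hφ hψ (S.app t s) = cong₂ (λ a b → L (app a b)) (sub-w-cps σ hφ hψ t)
      (trans (sub-argK (exts σ) (w (cps φ ψ s)) (var 0)) (cong (λ z → argK z (var 0)) (sub-w-cps σ hφ hψ s)))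
    sub-cps σ {φ} {φ′} {ψ} {ψ′} hφ hψ (S.μ ρ c) = cong L (sub-cpsᶜ (exts σ) hφ′ hψ′ c)
      where hφ′ : ∀ i → subst (exts σ) (w (φ i)) ≡ w (φ′ i)
            hφ′ i = trans (sub-w σ (φ i)) (cong w (hφ i))
            hψ′ : ∀ i → subst (exts σ) (μEnv ψ i) ≡ μEnv ψ′ i
            hψ′ zero    = refl
            hψ′ (suc i) = trans (sub-w σ (ψ i)) (cong w (hψ i))
    sub-cps σ hφ hψ S.zer = refl
    sub-cps σ hφ hψ (S.suc′ t) = cong (λ a → L (app a (sucK (var 0)))) (sub-w-cps σ hφ hψ t)
    sub-cps σ {φ} {ψ = ψ} hφ hψ (S.nrec ρ r s t) = cong₂ (λ a b → L (app a b)) (sub-w-cps σ hφ hψ t)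
      (trans (sub-nrecK (exts σ) (w (cps φ ψ r)) (w (cps φ ψ s)) (var 0))
        (cong₂ (λ a b → nrecK a b (var 0)) (sub-w-cps σ hφ hψ r) (sub-w-cps σ hφ hψ s)))

    sub-w-cps : ∀ σ {φ φ′ ψ ψ′} → (∀ i → subst σ (φ i) ≡ φ′ i) → (∀ i → subst σ (ψ i) ≡ ψ′ i)
              → ∀ t → subst (exts σ) (w (cps φ ψ t)) ≡ w (cps φ′ ψ′ t)
    sub-w-cps σ hφ hψ t = trans (sub-w σ (cps _ _ t)) (cong w (sub-cps σ hφ hψ t))

    sub-cpsᶜ : ∀ σ {φ φ′ ψ ψ′} → (∀ i → subst σ (φ i) ≡ φ′ i) → (∀ i → subst σ (ψ i) ≡ ψ′ i)
             → ∀ c → subst σ (cpsᶜ φ ψ c) ≡ cpsᶜ φ′ ψ′ c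
    sub-cpsᶜ σ hφ hψ (S.[ α ] t) = cong₂ app (sub-cps σ hφ hψ t) (hψ α)

  ren-cps : ∀ f {φ φ′ ψ ψ′} → (∀ i → rename f (φ i) ≡ φ′ i) → (∀ i → rename f (ψ i) ≡ ψ′ i)
          → ∀ t → rename f (cps φ ψ t) ≡ cps φ′ ψ′ t
  ren-cps f {φ} {ψ = ψ} hφ hψ t = trans (ren≡sub f _)
    (sub-cps _ (λ i → trans (sym (ren≡sub f (φ i))) (hφ i))
               (λ i → trans (sym (ren≡sub f (ψ i))) (hψ i)) t)

  w-cps : ∀ {φ ψ} t → w (cps φ ψ t) ≡ cps (wₑ φ) (wₑ ψ) t
  w-cps t = ren-cps suc (λ _ → refl) (λ _ → refl) t

  ww-cps : ∀ {φ ψ} t → w (w (cps φ ψ t)) ≡ cps (wₑ (wₑ φ)) (wₑ (wₑ ψ)) t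
  ww-cps t = trans (cong w (w-cps t)) (w-cps t)

  mutual
    cps-ren : ∀ f {φ φ′ ψ} → (∀ x → φ (f x) ≡ φ′ x)
            → ∀ t → cps φ ψ (S.rename f t) ≡ cps φ′ ψ t
    cps-ren f hφ (S.var x) = hφ x
    cps-ren f {φ} {φ′} hφ (S.lam ρ r) =
      cong (λ z → L (app (var 0) (L z))) (cps-ren (ext f) hφ′ r)
      where hφ′ : ∀ x → lamEnv φ (ext f x) ≡ lamEnv φ′ x
            hφ′ zero    = refl
            hφ′ (suc x) = cong (λ z → w (w z)) (hφ x)
    cps-ren f hφ (S.app t s) =
      cong₂ (λ a b → L (app (w a) (argK (w b) (var 0)))) (cps-ren f hφ t) (cps-ren f hφ s)
    cps-ren f hφ (S.μ ρ c) = cong L (cpsᶜ-ren f (λ x → cong w (hφ x)) c)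
    cps-ren f hφ S.zer = refl
    cps-ren f hφ (S.suc′ t) = cong (λ a → L (app (w a) (sucK (var 0)))) (cps-ren f hφ t)
    cps-ren f hφ (S.nrec ρ r s t) = cong₃ (λ a b c → L (app (w a) (nrecK (w b) (w c) (var 0))))
      (cps-ren f hφ t) (cps-ren f hφ r) (cps-ren f hφ s)

    cpsᶜ-ren : ∀ f {φ φ′ ψ} → (∀ x → φ (f x) ≡ φ′ x)
             → ∀ c → cpsᶜ φ ψ (S.renameC f c) ≡ cpsᶜ φ′ ψ c
    cpsᶜ-ren f hφ (S.[ α ] t) = cong (λ z → app z _) (cps-ren f hφ t)

  mutual
    cps-cren : ∀ f {φ ψ ψ′} → (∀ i → ψ (f i) ≡ ψ′ i)
             → ∀ t → cps φ ψ (S.crename f t) ≡ cps φ ψ′ t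
    cps-cren f hψ (S.var x) = refl
    cps-cren f hψ (S.lam ρ r) =
      cong (λ z → L (app (var 0) (L z))) (cps-cren f (λ i → cong (λ z → w (w z)) (hψ i)) r)
    cps-cren f hψ (S.app t s) =
      cong₂ (λ a b → L (app (w a) (argK (w b) (var 0)))) (cps-cren f hψ t) (cps-cren f hψ s)
    cps-cren f {ψ = ψ} {ψ′} hψ (S.μ ρ c) = cong L (cpsᶜ-cren (ext f) hψ′ c)
      where hψ′ : ∀ i → μEnv ψ (ext f i) ≡ μEnv ψ′ i
            hψ′ zero    = refl
            hψ′ (suc i) = cong w (hψ i)
    cps-cren f hψ S.zer = refl
    cps-cren f hψ (S.suc′ t) = cong (λ a → L (app (w a) (sucK (var 0)))) (cps-cren f hψ t)
    cps-cren f hψ (S.nrec ρ r s t) = cong₃ (λ a b c → L (app (w a) (nrecK (w b) (w c) (var 0))))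
      (cps-cren f hψ t) (cps-cren f hψ r) (cps-cren f hψ s)

    cpsᶜ-cren : ∀ f {φ ψ ψ′} → (∀ i → ψ (f i) ≡ ψ′ i)
              → ∀ c → cpsᶜ φ ψ (S.crenameC f c) ≡ cpsᶜ φ ψ′ c
    cpsᶜ-cren f hψ (S.[ α ] t) = cong₂ app (cps-cren f hψ t) (hψ α)

  w-cps-μ : ∀ {φ ψ} t → w (cps φ ψ t) ≡ cps (wₑ φ) (μEnv ψ) (S.crename suc t)
  w-cps-μ t = trans (w-cps t) (sym (cps-cren suc (λ _ → refl) t))

  mutual
    cps-sub : ∀ σ {φ φ′ ψ} → (∀ x → cps φ ψ (σ x) ≡ φ′ x)
            → ∀ t → cps φ ψ (S.subst σ t) ≡ cps φ′ ψ t
    cps-sub σ hφ (S.var x) = hφ x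
    cps-sub σ {φ} {φ′} {ψ} hφ (S.lam ρ r) =
      cong (λ z → L (app (var 0) (L z))) (cps-sub (S.exts σ) hφ′ r)
      where hφ′ : ∀ x → cps (lamEnv φ) (wₑ (wₑ ψ)) (S.exts σ x) ≡ lamEnv φ′ x
            hφ′ zero    = refl
            hφ′ (suc x) = trans (cps-ren suc (λ _ → refl) (σ x))
                            (trans (sym (ww-cps (σ x))) (cong (λ z → w (w z)) (hφ x)))
    cps-sub σ hφ (S.app t s) =
      cong₂ (λ a b → L (app (w a) (argK (w b) (var 0)))) (cps-sub σ hφ t) (cps-sub σ hφ s)
    cps-sub σ {φ} {φ′} {ψ} hφ (S.μ ρ c) = cong L (cpsᶜ-sub (λ i → S.crename suc (σ i)) hφ′ c)
      where hφ′ : ∀ x → cps (wₑ φ) (μEnv ψ) (S.crename suc (σ x)) ≡ w (φ′ x)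
            hφ′ x = trans (sym (w-cps-μ (σ x))) (cong w (hφ x))
    cps-sub σ hφ S.zer = refl
    cps-sub σ hφ (S.suc′ t) = cong (λ a → L (app (w a) (sucK (var 0)))) (cps-sub σ hφ t)
    cps-sub σ hφ (S.nrec ρ r s t) = cong₃ (λ a b c → L (app (w a) (nrecK (w b) (w c) (var 0))))
      (cps-sub σ hφ t) (cps-sub σ hφ r) (cps-sub σ hφ s)

    cpsᶜ-sub : ∀ σ {φ φ′ ψ} → (∀ x → cps φ ψ (σ x) ≡ φ′ x)
             → ∀ c → cpsᶜ φ ψ (S.substC σ c) ≡ cpsᶜ φ′ ψ c
    cpsᶜ-sub σ hφ (S.[ α ] t) = cong (λ z → app z _) (cps-sub σ hφ t)

-- Conversion behaviour of the CPS translation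

module CPS-Conversion where

  open import Data.Nat using (zero; suc; _≟_)
  open import Relation.Binary.PropositionalEquality
    using (_≡_; refl; sym; trans; cong; cong₂)
  open import Relation.Nullary using (yes; no; ¬_)
  open import Relation.Binary.Construct.Closure.Equivalence using (gmap)
  open import Function using (_∘_)
  open LamT
  open Substitution
  open Conversion
  open CPS

  β≡ : ∀ {ρ t r u} → t [0:= r ] ≡ u → app (lam ρ t) r ≃ u
  β≡ e = ≃trans (⟶≃ β) (≡≃ e)

  ret-β : ∀ V K → app (ret V) K ≃ app K V
  ret-β V K = β≡ (cong (app K) (w-[0:=] K V))

  argK-β : ∀ Y K F → app (argK Y K) F ≃ app (app F Y) K
  argK-β Y K F = β≡ (cong₂ (λ a b → app (app F a) b) (w-[0:=] F Y) (w-[0:=] F K))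

  sucK-β : ∀ K V → app (sucK K) V ≃ app K (suc′ V)
  sucK-β K V = β≡ (cong (λ a → app a (suc′ V)) (w-[0:=] V K))

  nrecK-β : ∀ R X K V → app (nrecK R X K) V ≃ app (nrec N R (stepCPS X) V) K
  nrecK-β R X K V = β≡ (cong₃ (λ a b c → app (nrec N a b V) c)
    (w-[0:=] V R) (w-[0:=] V (stepCPS X)) (w-[0:=] V K))

  stepCPS-β : ∀ X M R K → app (app (app (stepCPS X) M) R) K ≃ app X (argK (ret M) (argK (η R) K))
  stepCPS-β X M R K = ≃trans (gmap (λ z → app (app z R) K) (ξ-appL ∘ ξ-appL) (⟶≃ β))
    (≃trans (gmap (λ z → app z K) ξ-appL (⟶≃ β)) (β≡ (trans (cong (subst (single K)) (sub-sub (λ _ → refl) B))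
      (trans (sub-sub (λ _ → refl) B) (cong₂ app X-closed stepK-inst)))))
    where
    B = app (w (w (w X))) stepK
    υ : ℕ → Tm
    υ x = subst (single K) (subst (exts (single R)) (exts (exts (single M)) x))
    υ1 : υ 1 ≡ R
    υ1 = w-[0:=] K R
    υ2 : υ 2 ≡ M
    υ2 = trans (cong (subst (single K)) (trans (sub-w (single R) (w M)) (cong w (w-[0:=] R M))))
               (w-[0:=] K M)
    X-closed : subst υ (w (w (w X))) ≡ X
    X-closed = trans (sub-ren (λ _ → refl) (w (w X)))
      (trans (sub-ren (λ _ → refl) (w X)) (trans (sub-ren (λ _ → refl) X) (sub-id (λ _ → refl) X)))
    stepK-inst : subst υ stepK ≡ argK (ret M) (argK (η R) K)
    stepK-inst = trans (sub-argK υ (ret (var 2)) (argK (η (var 1)) (var 0)))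
      (cong₂ argK (trans (sub-ret υ (var 2)) (cong ret υ2))
      (trans (sub-argK υ (η (var 1)) (var 0)) (cong₂ argK (trans (sub-η υ (var 1)) (cong η υ1)) refl)))

  cps-app-β : ∀ {φ ψ} t s K → app (cps φ ψ (S.app t s)) K ≃ app (cps φ ψ t) (argK (cps φ ψ s) K)
  cps-app-β {φ} {ψ} t s K = β≡ (cong₂ app (w-[0:=] K _)
    (trans (sub-argK (single K) (w (cps φ ψ s)) (var 0)) (cong (λ z → argK z K) (w-[0:=] K _))))

  cps-suc-β : ∀ {φ ψ} t K → app (cps φ ψ (S.suc′ t)) K ≃ app (cps φ ψ t) (sucK K)
  cps-suc-β t K = β≡ (cong₂ app (w-[0:=] K _) (sub-sucK (single K) (var 0)))

  cps-nrec-β : ∀ {φ ψ ρ} r s t K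
             → app (cps φ ψ (S.nrec ρ r s t)) K ≃ app (cps φ ψ t) (nrecK (cps φ ψ r) (cps φ ψ s) K)
  cps-nrec-β {φ} {ψ} r s t K = β≡ (cong₂ app (w-[0:=] K _)
    (trans (sub-nrecK (single K) (w (cps φ ψ r)) (w (cps φ ψ s)) (var 0))
      (cong₂ (λ a b → nrecK a b K) (w-[0:=] K _) (w-[0:=] K _))))

  stepCPS-≃ : ∀ {a b} → a ≃ b → stepCPS a ≃ stepCPS b
  stepCPS-≃ e = lam-≃ (lam-≃ (lam-≃ (appˡ-≃ (w-≃ (w-≃ (w-≃ e))))))

  argK-≃ : ∀ {a b c d} → a ≃ b → c ≃ d → argK a c ≃ argK b d
  argK-≃ e₁ e₂ = lam-≃ (app-≃ (appʳ-≃ (w-≃ e₁)) (w-≃ e₂))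

  nrecK-≃ : ∀ {a b c d e f} → a ≃ b → c ≃ d → e ≃ f → nrecK a c e ≃ nrecK b d f
  nrecK-≃ e₁ e₂ e₃ = lam-≃ (app-≃ (nrec-≃ (w-≃ e₁) (w-≃ (stepCPS-≃ e₂)) ≃refl) (w-≃ e₃))

  mutual
    cps-≃ : ∀ {φ φ′ ψ} → (∀ x → φ x ≃ φ′ x) → ∀ t → cps φ ψ t ≃ cps φ′ ψ t
    cps-≃ hφ (S.var x) = hφ x
    cps-≃ {φ} {φ′} hφ (S.lam ρ r) = lam-≃ (appʳ-≃ (lam-≃ (cps-≃ hφ′ r)))
      where hφ′ : ∀ x → lamEnv φ x ≃ lamEnv φ′ x
            hφ′ zero    = ≃refl
            hφ′ (suc x) = w-≃ (w-≃ (hφ x))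
    cps-≃ hφ (S.app t s) = lam-≃ (app-≃ (w-≃ (cps-≃ hφ t)) (argK-≃ (w-≃ (cps-≃ hφ s)) ≃refl))
    cps-≃ hφ (S.μ ρ c)   = lam-≃ (cpsᶜ-≃ (λ x → w-≃ (hφ x)) c)
    cps-≃ hφ S.zer       = ≃refl
    cps-≃ hφ (S.suc′ t)  = lam-≃ (appˡ-≃ (w-≃ (cps-≃ hφ t)))
    cps-≃ hφ (S.nrec ρ r s t) = lam-≃ (app-≃ (w-≃ (cps-≃ hφ t))
      (nrecK-≃ (w-≃ (cps-≃ hφ r)) (w-≃ (cps-≃ hφ s)) ≃refl))

    cpsᶜ-≃ : ∀ {φ φ′ ψ} → (∀ x → φ x ≃ φ′ x) → ∀ c → cpsᶜ φ ψ c ≃ cpsᶜ φ′ ψ c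
    cpsᶜ-≃ hφ (S.[ α ] t) = appˡ-≃ (cps-≃ hφ t)

  -- Translated terms are λ-abstractions provided the term environment
  -- consists of λ-abstractions; for such terms η-conversion is derivable.
  data IsLam : Tm → Set where
    isL : ∀ M → IsLam (L M)

  AllLam : (ℕ → Tm) → Set
  AllLam φ = ∀ x → IsLam (φ x)

  IsLam-w : ∀ {X} → IsLam X → IsLam (w X)
  IsLam-w (isL M) = isL _

  AllLam-lamEnv : ∀ {φ} → AllLam φ → AllLam (lamEnv φ)
  AllLam-lamEnv a zero    = isL _
  AllLam-lamEnv a (suc x) = IsLam-w (IsLam-w (a x))

  cps-IsLam : ∀ {φ} ψ → AllLam φ → ∀ t → IsLam (cps φ ψ t)
  cps-IsLam ψ a (S.var x)        = a x
  cps-IsLam ψ a (S.lam ρ r)      = isL _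
  cps-IsLam ψ a (S.app t s)      = isL _
  cps-IsLam ψ a (S.μ ρ c)        = isL _
  cps-IsLam ψ a S.zer            = isL _
  cps-IsLam ψ a (S.suc′ t)       = isL _
  cps-IsLam ψ a (S.nrec ρ r s t) = isL _

  η-lam : ∀ {X} → IsLam X → η X ≃ X
  η-lam (isL M) = ≃trans (⟶≃ (ξ-lam β)) (≡≃ (cong L (trans (sub-ren var-0 M) (sub-id (λ _ → refl) M))))
    where var-0 : ∀ x → single (var 0) (ext suc x) ≡ var x
          var-0 zero    = refl
          var-0 (suc x) = refl

  cps-μ-β : ∀ {φ ψ} ρ c K → app (cps φ ψ (S.μ ρ c)) K ≃ cpsᶜ φ (K ∷ₑ ψ) c
  cps-μ-β {φ} {ψ} ρ c K = β≡ ((sub-cpsᶜ (single K) (λ i → w-[0:=] K (φ i)) bind c))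
    where bind : ∀ i → subst (single K) (μEnv ψ i) ≡ (K ∷ₑ ψ) i
          bind zero    = refl
          bind (suc i) = w-[0:=] K (ψ i)

  -- The continuation denoted by an evaluation context E with outer
  -- continuation K: one argK / sucK / nrecK frame for each layer of E.
  ctxK : (ℕ → Tm) → (ℕ → Tm) → S.ECtx → Tm → Tm
  ctxK φ ψ S.□               K = K
  ctxK φ ψ (S.appE E s)      K = ctxK φ ψ E (argK (cps φ ψ s) K)
  ctxK φ ψ (S.sucE E)        K = ctxK φ ψ E (sucK K)
  ctxK φ ψ (S.nrecE ρ r s E) K = ctxK φ ψ E (nrecK (cps φ ψ r) (cps φ ψ s) K)

  sub-ctxK : ∀ σ {φ φ′ ψ ψ′} → (∀ i → subst σ (φ i) ≡ φ′ i) → (∀ i → subst σ (ψ i) ≡ ψ′ i)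
           → ∀ E K → subst σ (ctxK φ ψ E K) ≡ ctxK φ′ ψ′ E (subst σ K)
  sub-ctxK σ hφ hψ S.□ K = refl
  sub-ctxK σ {φ} {φ′} {ψ} {ψ′} hφ hψ (S.appE E s) K = trans (sub-ctxK σ hφ hψ E _)
    (cong (ctxK φ′ ψ′ E) (trans (sub-argK σ (cps φ ψ s) K)
      (cong (λ z → argK z (subst σ K)) (sub-cps σ hφ hψ s))))
  sub-ctxK σ {φ′ = φ′} {ψ′ = ψ′} hφ hψ (S.sucE E) K =
    trans (sub-ctxK σ hφ hψ E _) (cong (ctxK φ′ ψ′ E) (sub-sucK σ K))
  sub-ctxK σ {φ} {φ′} {ψ} {ψ′} hφ hψ (S.nrecE ρ r s E) K = trans (sub-ctxK σ hφ hψ E _)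
    (cong (ctxK φ′ ψ′ E) (trans (sub-nrecK σ (cps φ ψ r) (cps φ ψ s) K)
      (cong₂ (λ a b → nrecK a b (subst σ K)) (sub-cps σ hφ hψ r) (sub-cps σ hφ hψ s))))

  w-ctxK : ∀ {φ ψ} E K → w (ctxK φ ψ E K) ≡ ctxK (wₑ φ) (wₑ ψ) E (w K)
  w-ctxK {φ} {ψ} E K = trans (ren≡sub suc _)
    (trans (sub-ctxK _ (λ i → sym (ren≡sub suc (φ i))) (λ i → sym (ren≡sub suc (ψ i))) E K)
      (cong (ctxK _ _ E) (sym (ren≡sub suc K))))

  ctxK-renE : ∀ f {φ φ′ ψ} → (∀ x → φ (f x) ≡ φ′ x)
            → ∀ E K → ctxK φ ψ (S.renameE f E) K ≡ ctxK φ′ ψ E K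
  ctxK-renE f h S.□ K = refl
  ctxK-renE f {φ} {ψ = ψ} h (S.appE E s) K =
    trans (cong (λ z → ctxK φ ψ (S.renameE f E) (argK z K)) (cps-ren f h s)) (ctxK-renE f h E _)
  ctxK-renE f h (S.sucE E) K = ctxK-renE f h E _
  ctxK-renE f {φ} {ψ = ψ} h (S.nrecE ρ r s E) K =
    trans (cong₂ (λ a b → ctxK φ ψ (S.renameE f E) (nrecK a b K)) (cps-ren f h r) (cps-ren f h s))
      (ctxK-renE f h E _)

  ctxK-crenE : ∀ f {φ ψ ψ′} → (∀ x → ψ (f x) ≡ ψ′ x)
             → ∀ E K → ctxK φ ψ (S.crenameE f E) K ≡ ctxK φ ψ′ E K
  ctxK-crenE f h S.□ K = refl
  ctxK-crenE f {φ} {ψ} h (S.appE E s) K =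
    trans (cong (λ z → ctxK φ ψ (S.crenameE f E) (argK z K)) (cps-cren f h s)) (ctxK-crenE f h E _)
  ctxK-crenE f h (S.sucE E) K = ctxK-crenE f h E _
  ctxK-crenE f {φ} {ψ} h (S.nrecE ρ r s E) K =
    trans (cong₂ (λ a b → ctxK φ ψ (S.crenameE f E) (nrecK a b K)) (cps-cren f h r) (cps-cren f h s))
      (ctxK-crenE f h E _)

  cps-plug : ∀ {φ ψ} E q K → app (cps φ ψ (S.plug E q)) K ≃ app (cps φ ψ q) (ctxK φ ψ E K)
  cps-plug S.□               q K = ≃refl
  cps-plug (S.appE E s)      q K = ≃trans (cps-app-β (S.plug E q) s K) (cps-plug E q _)
  cps-plug (S.sucE E)        q K = ≃trans (cps-suc-β (S.plug E q) K) (cps-plug E q _)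
  cps-plug (S.nrecE ρ r s E) q K = ≃trans (cps-nrec-β {ρ = ρ} r s (S.plug E q) K) (cps-plug E q _)

  -- Structural substitution t[α:=δE] is simulated by rebinding α to the
  -- continuation of E around δ: if ψ′ agrees with ψ except that
  -- ψ′ α = ctxK E (ψ δ), then  cps ψ (t[α:=δE]) ≃ cps ψ′ t.
  mutual
    cps-ssub : ∀ α δ E {φ ψ ψ′} → ψ′ α ≡ ctxK φ ψ E (ψ δ) → (∀ γ → ¬ γ ≡ α → ψ′ γ ≡ ψ γ)
             → ∀ t → cps φ ψ (S.ssub α δ E t) ≃ cps φ ψ′ t
    cps-ssub α δ E hα hγ (S.var x) = ≃refl
    cps-ssub α δ E {φ} {ψ} {ψ′} hα hγ (S.lam ρ r) =
      lam-≃ (appʳ-≃ (lam-≃ (cps-ssub α δ (S.renameE suc E) hα′ hγ′ r)))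
      where hα′ : w (w (ψ′ α)) ≡ ctxK (lamEnv φ) (wₑ (wₑ ψ)) (S.renameE suc E) (w (w (ψ δ)))
            hα′ = trans (cong (λ z → w (w z)) hα) (trans (cong w (w-ctxK E (ψ δ)))
                    (trans (w-ctxK E _) (sym (ctxK-renE suc (λ _ → refl) E _))))
            hγ′ : ∀ γ → ¬ γ ≡ α → w (w (ψ′ γ)) ≡ w (w (ψ γ))
            hγ′ γ γ≢α = cong (λ z → w (w z)) (hγ γ γ≢α)
    cps-ssub α δ E hα hγ (S.app t s) = lam-≃ (app-≃ (w-≃ (cps-ssub α δ E hα hγ t))
      (argK-≃ (w-≃ (cps-ssub α δ E hα hγ s)) ≃refl))
    cps-ssub α δ E {φ} {ψ} {ψ′} hα hγ (S.μ ρ c) =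
      lam-≃ (cpsᶜ-ssub (suc α) (suc δ) (S.crenameE suc E) hα′ hγ′ c)
      where hα′ : w (ψ′ α) ≡ ctxK (wₑ φ) (μEnv ψ) (S.crenameE suc E) (w (ψ δ))
            hα′ = trans (cong w hα) (trans (w-ctxK E (ψ δ)) (sym (ctxK-crenE suc (λ _ → refl) E _)))
            hγ′ : ∀ γ → ¬ γ ≡ suc α → μEnv ψ′ γ ≡ μEnv ψ γ
            hγ′ zero    _   = refl
            hγ′ (suc γ) γ≢α = cong w (hγ γ (λ e → γ≢α (cong suc e)))
    cps-ssub α δ E hα hγ S.zer = ≃refl
    cps-ssub α δ E hα hγ (S.suc′ t) = lam-≃ (appˡ-≃ (w-≃ (cps-ssub α δ E hα hγ t)))
    cps-ssub α δ E hα hγ (S.nrec ρ r s t) = lam-≃ (app-≃ (w-≃ (cps-ssub α δ E hα hγ t))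
      (nrecK-≃ (w-≃ (cps-ssub α δ E hα hγ r)) (w-≃ (cps-ssub α δ E hα hγ s)) ≃refl))

    cpsᶜ-ssub : ∀ α δ E {φ ψ ψ′} → ψ′ α ≡ ctxK φ ψ E (ψ δ) → (∀ γ → ¬ γ ≡ α → ψ′ γ ≡ ψ γ)
              → ∀ c → cpsᶜ φ ψ (S.ssubC α δ E c) ≃ cpsᶜ φ ψ′ c
    cpsᶜ-ssub α δ E {ψ = ψ} hα hγ (S.[ γ ] q) with γ ≟ α
    ... | yes refl = ≃trans (cps-plug E (S.ssub α δ E q) (ψ δ))
                       (app-≃ (cps-ssub α δ E hα hγ q) (≡≃ (sym hα)))
    ... | no γ≢α   = app-≃ (cps-ssub α δ E hα hγ q) (≡≃ (sym (hγ γ γ≢α)))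

-- Simulation: every λμT-step becomes a conversion of translations,
-- provided the term environment consists of λ-abstractions.

module Simulation where

  open import Data.Nat using (zero; suc; pred)
  open import Data.Empty using (⊥-elim)
  open import Relation.Binary.PropositionalEquality
    using (_≡_; refl; sym; trans; cong; cong₂)
  open import Relation.Nullary using (¬_)
  open import Relation.Binary.Construct.Closure.ReflexiveTransitive using (ε; _◅_)
  open import Relation.Binary.Construct.Closure.Symmetric using (fwd; bwd)
  open LamT
  open Substitution
  open Conversion
  open CPS
  open CPS-Conversion
  open ≃-Reasoning

  cps-num : ∀ {φ ψ} n → cps φ ψ (S.num n) ≃ ret (num n)
  cps-num zero = ≃refl
  cps-num {φ} {ψ} (suc n) = begin
    L (app (w (cps φ ψ (S.num n))) (sucK (var 0)))  ≃⟨ lam-≃ (appˡ-≃ (w-≃ (cps-num n))) ⟩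
    L (app (w (ret (num n))) (sucK (var 0)))        ≡⟨ cong (λ z → L (app z (sucK (var 0)))) (w-ret (num n)) ⟩
    L (app (ret (w (num n))) (sucK (var 0)))        ≃⟨ lam-≃ (ret-β (w (num n)) (sucK (var 0))) ⟩
    L (app (sucK (var 0)) (w (num n)))              ≃⟨ lam-≃ (sucK-β (var 0) (w (num n))) ⟩
    ret (num (suc n))                               ∎

  recur : Tm → Tm → ℕ → Tm
  recur R X n = nrec N R (stepCPS X) (num n)

  w-recur : ∀ R X n → w (recur R X n) ≡ recur (w R) (w X) n
  w-recur R X n = cong₂ (λ a b → nrec N (w R) a b)
    (trans (ren≡sub suc (stepCPS X)) (trans (sub-stepCPS _ X) (cong stepCPS (sym (ren≡sub suc X)))))
    (num-ren suc n)

  cps-nrec-num : ∀ {φ ψ ρ} r s n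
               → cps φ ψ (S.nrec ρ r s (S.num n)) ≃ L (app (recur (w (cps φ ψ r)) (w (cps φ ψ s)) n) (var 0))
  cps-nrec-num {φ} {ψ} r s n = begin
    L (app (w (cps φ ψ (S.num n))) K)  ≃⟨ lam-≃ (appˡ-≃ (w-≃ (cps-num n))) ⟩
    L (app (w (ret (num n))) K)        ≡⟨ cong (λ z → L (app z K)) (w-ret-num n) ⟩
    L (app (ret (num n)) K)            ≃⟨ lam-≃ (ret-β (num n) K) ⟩
    L (app K (num n))                  ≃⟨ lam-≃ (nrecK-β _ _ (var 0) (num n)) ⟩
    L (app (recur (w (cps φ ψ r)) (w (cps φ ψ s)) n) (var 0)) ∎
    where K = nrecK (w (cps φ ψ r)) (w (cps φ ψ s)) (var 0)

  -- the same, as an η-expansion (the form in which it is passed on)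
  cps-nrec-num-η : ∀ {φ ψ ρ} r s n → cps φ ψ (S.nrec ρ r s (S.num n)) ≃ η (recur (cps φ ψ r) (cps φ ψ s) n)
  cps-nrec-num-η {ρ = ρ} r s n =
    ≃trans (cps-nrec-num {ρ = ρ} r s n) (≡≃ (cong (λ z → L (app z (var 0))) (sym (w-recur _ _ n))))

  cps-lam-β : ∀ {φ ψ} ρ r Y K → IsLam Y
            → app (cps φ ψ (S.lam ρ r)) (argK Y K) ≃ app (cps (Y ∷ₑ φ) ψ r) K
  cps-lam-β {φ} {ψ} ρ r Y K Y-lam = begin
    app (cps φ ψ (S.lam ρ r)) A
      ≃⟨ β≡ (cong (λ z → app A (L z)) (sub-cps (exts (single A)) hφ hψ r)) ⟩
    app A (L (cps (η (var 0) ∷ₑ wₑ φ) (wₑ ψ) r))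
      ≃⟨ argK-β Y K _ ⟩
    app (app (L (cps (η (var 0) ∷ₑ wₑ φ) (wₑ ψ) r)) Y) K
      ≃⟨ appˡ-≃ (β≡ (sub-cps (single Y) hφ′ (λ i → w-[0:=] Y (ψ i)) r)) ⟩
    app (cps (η Y ∷ₑ φ) ψ r) K                ≃⟨ appˡ-≃ (cps-≃ η-Y r) ⟩
    app (cps (Y ∷ₑ φ) ψ r) K                  ∎
    where
    A = argK Y K
    drop : ∀ X → subst (exts (single A)) (w (w X)) ≡ w X
    drop X = trans (sub-w (single A) (w X)) (cong w (w-[0:=] A X))
    hφ : ∀ i → subst (exts (single A)) (lamEnv φ i) ≡ (η (var 0) ∷ₑ wₑ φ) i
    hφ zero    = refl
    hφ (suc i) = drop (φ i)
    hψ : ∀ i → subst (exts (single A)) (w (w (ψ i))) ≡ w (ψ i)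
    hψ i = drop (ψ i)
    hφ′ : ∀ i → subst (single Y) ((η (var 0) ∷ₑ wₑ φ) i) ≡ (η Y ∷ₑ φ) i
    hφ′ zero    = refl
    hφ′ (suc i) = w-[0:=] Y (φ i)
    η-Y : ∀ i → (η Y ∷ₑ φ) i ≃ (Y ∷ₑ φ) i
    η-Y zero    = η-lam Y-lam
    η-Y (suc i) = ≃refl

  -- a frame F wrapped around a μ is absorbed into its continuation
  -- (the reductions μ-S, μ-app and nrec-μ)
  cps-μ-frame : ∀ {φ ψ} ρ c F K → K ≡ ctxK (wₑ φ) (μEnv ψ) F (var 0)
              → L (app (w (cps φ ψ (S.μ ρ c))) K) ≃ cps φ ψ (S.μ ρ (S.ssubC 0 0 F c))
  cps-μ-frame {φ} {ψ} ρ c F K hK = ≃trans (≡≃ (cong (λ z → L (app z K)) (w-cps (S.μ ρ c))))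
    (lam-≃ (≃trans (cps-μ-β ρ c K) (≃sym (cpsᶜ-ssub 0 0 F hK fresh c))))
    where fresh : ∀ γ → ¬ γ ≡ 0 → (K ∷ₑ wₑ ψ) γ ≡ μEnv ψ γ
          fresh zero    γ≢0 = ⊥-elim (γ≢0 refl)
          fresh (suc γ) _   = refl

  cps-nrec-S : ∀ {φ ψ ρ} r s n
             → cps φ ψ (S.nrec ρ r s (S.suc′ (S.num n)))
               ≃ cps φ ψ (S.app (S.app s (S.num n)) (S.nrec ρ r s (S.num n)))
  cps-nrec-S {φ} {ψ} {ρ} r s n = begin
    cps φ ψ (S.nrec ρ r s (S.num (suc n)))            ≃⟨ cps-nrec-num {ρ = ρ} r s (suc n) ⟩
    L (app (recur (w Tr) (w Ts) (suc n)) (var 0))     ⟶⟨ ξ-lam (ξ-appL nrec-S) ⟩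
    L (app (app (app (stepCPS (w Ts)) (num n)) R) (var 0)) ≃⟨ lam-≃ (stepCPS-β (w Ts) (num n) R (var 0)) ⟩
    L (app (w Ts) (argK (ret (num n)) (argK (η R) (var 0))))
      ≡⟨ cong₂ (λ a b → L (app (w Ts) (argK a (argK b (var 0)))))
           (w-ret-num n) (trans (w-η R₀) (cong η (w-recur Tr Ts n))) ⟨
    L (app (w Ts) (argK (w (ret (num n))) (argK (w (η R₀)) (var 0))))
      ≃⟨ lam-≃ (appʳ-≃ (argK-≃ (w-≃ (cps-num n)) (argK-≃ (w-≃ (cps-nrec-num-η {ρ = ρ} r s n)) ≃refl))) ⟨
    L (app (w Ts) (argK (w (cps φ ψ (S.num n))) K′))
      ≡⟨ cong₂ (λ a b → L (app a (argK b K′))) (w-cps s) (w-cps (S.num n)) ⟩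
    L (app (cps (wₑ φ) (wₑ ψ) s) (argK (cps (wₑ φ) (wₑ ψ) (S.num n)) K′))
      ≃⟨ lam-≃ (cps-app-β s (S.num n) K′) ⟨
    L (app (cps (wₑ φ) (wₑ ψ) (S.app s (S.num n))) K′)
      ≡⟨ cong (λ z → L (app z K′)) (w-cps (S.app s (S.num n))) ⟨
    cps φ ψ (S.app (S.app s (S.num n)) (S.nrec ρ r s (S.num n))) ∎
    where
    Tr = cps φ ψ r
    Ts = cps φ ψ s
    R₀ = recur Tr Ts n
    R  = recur (w Tr) (w Ts) n
    K′ = argK (w (cps φ ψ (S.nrec ρ r s (S.num n)))) (var 0)

  cps-β : ∀ {φ ψ} ρ r s → AllLam φ → cps φ ψ (S.app (S.lam ρ r) s) ≃ cps φ ψ (r S.[0:= s ])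
  cps-β {φ} {ψ} ρ r s φ-lam = begin
    L (app (w (cps φ ψ (S.lam ρ r))) (argK (w (cps φ ψ s)) (var 0)))
      ≡⟨ cong (λ z → L (app z (argK (w (cps φ ψ s)) (var 0)))) (w-cps (S.lam ρ r)) ⟩
    L (app (cps (wₑ φ) (wₑ ψ) (S.lam ρ r)) (argK (w (cps φ ψ s)) (var 0)))
      ≃⟨ lam-≃ (cps-lam-β ρ r _ (var 0) (IsLam-w (cps-IsLam ψ φ-lam s))) ⟩
    L (app (cps (w (cps φ ψ s) ∷ₑ wₑ φ) (wₑ ψ) r) (var 0))
      ≡⟨ cong (λ z → L (app z (var 0))) (trans (w-cps (r S.[0:= s ])) (cps-sub (S.single s) arg r)) ⟨
    η (cps φ ψ (r S.[0:= s ]))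
      ≃⟨ η-lam (cps-IsLam ψ φ-lam (r S.[0:= s ])) ⟩
    cps φ ψ (r S.[0:= s ]) ∎
    where arg : ∀ x → cps (wₑ φ) (wₑ ψ) (S.single s x) ≡ (w (cps φ ψ s) ∷ₑ wₑ φ) x
          arg zero    = sym (w-cps s)
          arg (suc x) = refl

  cps-μ-η : ∀ {φ ψ} ρ t → AllLam φ → cps φ ψ (S.μ ρ (S.[ 0 ] S.crename suc t)) ≃ cps φ ψ t
  cps-μ-η {φ} {ψ} ρ t φ-lam =
    ≃trans (≡≃ (cong (λ z → L (app z (var 0))) (sym (w-cps-μ t)))) (η-lam (cps-IsLam ψ φ-lam t))

  cps-nrec-0 : ∀ {φ ψ} ρ r s → AllLam φ → cps φ ψ (S.nrec ρ r s S.zer) ≃ cps φ ψ r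
  cps-nrec-0 {φ} {ψ} ρ r s φ-lam = begin
    cps φ ψ (S.nrec ρ r s S.zer)                              ≃⟨ cps-nrec-num {ρ = ρ} r s 0 ⟩
    L (app (recur (w (cps φ ψ r)) (w (cps φ ψ s)) 0) (var 0)) ⟶⟨ ξ-lam (ξ-appL nrec-0) ⟩
    η (cps φ ψ r)                                             ≃⟨ η-lam (cps-IsLam ψ φ-lam r) ⟩
    cps φ ψ r                                                 ∎

  -- the reduction  [α]μβ.c ⟶ c[β:=α□]: both sides run c with β bound to ψ α
  cps-μ-cmd : ∀ {φ ψ} α ρ c
            → cpsᶜ φ ψ (S.[ α ] S.μ ρ c) ≃ cpsᶜ φ ψ (S.crenameC pred (S.ssubC 0 (suc α) S.□ c))
  cps-μ-cmd {φ} {ψ} α ρ c = ≃trans (cps-μ-β ρ c (ψ α)) (≃sym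
    (≃trans (≡≃ (cpsᶜ-cren pred (λ _ → refl) (S.ssubC 0 (suc α) S.□ c)))
      (cpsᶜ-ssub 0 (suc α) S.□ {ψ′ = ψ α ∷ₑ ψ} refl shift c)))
    where shift : ∀ γ → ¬ γ ≡ 0 → (ψ α ∷ₑ ψ) γ ≡ ψ (pred γ)
          shift zero    γ≢0 = ⊥-elim (γ≢0 refl)
          shift (suc γ) _   = refl

  mutual
    simulate : ∀ {t t′} → t S.⟶ t′ → ∀ {φ ψ} → AllLam φ → cps φ ψ t ≃ cps φ ψ t′
    simulate (S.β {ρ} {r} {s})               φ-lam = cps-β ρ r s φ-lam
    simulate (S.μ-S {ρ} {c})                 φ-lam = cps-μ-frame ρ c (S.sucE S.□) _ refl
    simulate (S.μ-app {ρ} {c} {s})           φ-lam =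
      cps-μ-frame ρ c (S.appE S.□ (S.crename suc s)) _ (cong (λ z → argK z (var 0)) (w-cps-μ s))
    simulate (S.μ-η {ρ} {t})                 φ-lam = cps-μ-η ρ t φ-lam
    simulate (S.nrec-0 {ρ} {r} {s})          φ-lam = cps-nrec-0 ρ r s φ-lam
    simulate (S.nrec-S {ρ} {r} {s} {n})      φ-lam = cps-nrec-S {ρ = ρ} r s n
    simulate (S.nrec-μ {ρ} {σ} {r} {s} {c})  φ-lam =
      cps-μ-frame σ c (S.nrecE ρ (S.crename suc r) (S.crename suc s) S.□) _
        (cong₂ (λ a b → nrecK a b (var 0)) (w-cps-μ r) (w-cps-μ s))
    simulate (S.ξ-lam st)   φ-lam = lam-≃ (appʳ-≃ (lam-≃ (simulate st (AllLam-lamEnv φ-lam))))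
    simulate (S.ξ-appL st)  φ-lam = lam-≃ (appˡ-≃ (w-≃ (simulate st φ-lam)))
    simulate (S.ξ-appR st)  φ-lam = lam-≃ (appʳ-≃ (argK-≃ (w-≃ (simulate st φ-lam)) ≃refl))
    simulate (S.ξ-μ st)     φ-lam = lam-≃ (simulateᶜ st (λ x → IsLam-w (φ-lam x)))
    simulate (S.ξ-suc st)   φ-lam = lam-≃ (appˡ-≃ (w-≃ (simulate st φ-lam)))
    simulate (S.ξ-nrec₁ st) φ-lam = lam-≃ (appʳ-≃ (nrecK-≃ (w-≃ (simulate st φ-lam)) ≃refl ≃refl))
    simulate (S.ξ-nrec₂ st) φ-lam = lam-≃ (appʳ-≃ (nrecK-≃ ≃refl (w-≃ (simulate st φ-lam)) ≃refl))
    simulate (S.ξ-nrec₃ st) φ-lam = lam-≃ (appˡ-≃ (w-≃ (simulate st φ-lam)))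

    simulateᶜ : ∀ {c c′} → c S.⟶ᶜ c′ → ∀ {φ ψ} → AllLam φ → cpsᶜ φ ψ c ≃ cpsᶜ φ ψ c′
    simulateᶜ (S.μ-cmd {α} {ρ} {c}) φ-lam = cps-μ-cmd α ρ c
    simulateᶜ (S.ξ-cmd st)          φ-lam = appˡ-≃ (simulate st φ-lam)

  simulate* : ∀ {t t′} → t S.≃ t′ → ∀ {φ ψ} → AllLam φ → cps φ ψ t ≃ cps φ ψ t′
  simulate* ε                 φ-lam = ≃refl
  simulate* (fwd st ◅ steps)  φ-lam = ≃trans (simulate st φ-lam) (simulate* steps φ-lam)
  simulate* (bwd st ◅ steps)  φ-lam = ≃trans (≃sym (simulate st φ-lam)) (simulate* steps φ-lam)

-- Readback: turning the translation of a numeric function back into a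
-- numeric function, correct for erased terms

module Readback where

  open import Data.Nat using (zero; suc)
  open import Data.Vec using (Vec; []; _∷_)
  open import Relation.Binary.PropositionalEquality
    using (_≡_; refl; sym; trans; cong; cong₂)
  open LamT
  open Substitution
  open Conversion
  open CPS
  open CPS-Conversion
  open Simulation

  -- closed source terms need no environments; these dummies are λs
  φ₀ : ℕ → Tm
  φ₀ _ = L zer

  ψ₀ : ℕ → Tm
  ψ₀ _ = zer

  φ₀-lam : AllLam φ₀
  φ₀-lam _ = isL zer

  cps₀ : S.Tm → Tm
  cps₀ = cps φ₀ ψ₀

  idK : Tm
  idK = L (var 0)

  -- readback n X = λm₁ ⋯ mₙ. X m₁ ⋯ mₙ idK, where each application is
  -- performed in CPS:  X m  =  λk. X (λf. f (λk′. k′ m) k)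
  readback : ℕ → Tm → Tm
  readback zero    X = app X idK
  readback (suc n) X = L (readback n (L (app (w (w X)) (argK (ret (var 1)) (var 0)))))

  sub-readback : ∀ n σ X → subst σ (readback n X) ≡ readback n (subst σ X)
  sub-readback zero    σ X = refl
  sub-readback (suc n) σ X = cong L (trans (sub-readback n (exts σ) _)
    (cong (λ z → readback n (L (app z (argK (ret (var 1)) (var 0))))) (sub-ww σ X)))

  readback-step : ∀ n X m
                → app (readback (suc n) X) (num m) ≃ readback n (L (app (w X) (argK (ret (num m)) (var 0))))
  readback-step n X m = β≡ (trans (sub-readback n σ _) (cong (readback n) (cong₂ (λ a b → L (app a b))
    (trans (sub-w σ (w X)) (cong w (w-[0:=] (num m) X)))
    (trans (sub-argK (exts σ) (ret (var 1)) (var 0))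
      (cong (λ z → argK z (var 0)) (trans (sub-ret (exts σ) (var 1)) (cong ret (num-ren suc m))))))))
    where σ = single (num m)

  cps-app-num : ∀ {φ ψ} u m
              → cps φ ψ (S.app u (S.num m)) ≃ L (app (w (cps φ ψ u)) (argK (ret (num m)) (var 0)))
  cps-app-num {φ} {ψ} u m = ≃trans (lam-≃ (appʳ-≃ (argK-≃ (w-≃ (cps-num m)) ≃refl)))
    (≡≃ (cong (λ z → L (app (w (cps φ ψ u)) (argK z (var 0)))) (w-ret-num m)))

  apps-≃ : ∀ {n} (ms : Vec ℕ n) {a b} → a ≃ b → apps a ms ≃ apps b ms
  apps-≃ []       e = e
  apps-≃ (m ∷ ms) e = apps-≃ ms (appˡ-≃ e)

  readback-apps : ∀ {n} (ms : Vec ℕ n) u X → X ≃ cps₀ u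
                → apps (readback n X) ms ≃ app (cps₀ (S.apps u ms)) idK
  readback-apps []               u X X≃u = appˡ-≃ X≃u
  readback-apps {suc n} (m ∷ ms) u X X≃u = ≃trans (apps-≃ ms (readback-step n X m))
    (readback-apps ms (S.app u (S.num m)) _ (≃trans (lam-≃ (appˡ-≃ (w-≃ X≃u))) (≃sym (cps-app-num u m))))

  run-num : ∀ k → app (cps₀ (S.num k)) idK ≃ num k
  run-num k = ≃trans (appˡ-≃ (cps-num k)) (≃trans (ret-β (num k) idK) (⟶≃ β))

  readback-correct : ∀ {n} (f : Vec ℕ n → ℕ) t → (∀ ms → S.apps t ms S.≃ S.num (f ms))
                   → ∀ ms → apps (readback n (cps₀ t)) ms ≃ num (f ms)
  readback-correct f t t-computes-f ms = ≃trans (readback-apps ms t (cps₀ t) ≃refl)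
    (≃trans (appˡ-≃ (simulate* (t-computes-f ms) φ₀-lam)) (run-num (f ms)))

-- Erasure of type annotations, and why it is harmless for conversions
-- to numerals: every reduction of an erasure lifts to the annotated
-- term, so by Church–Rosser an erasure convertible to a numeral comes
-- from a term convertible to that numeral.

module Erasure where

  open import Data.Nat using (zero; suc)
  open import Data.Vec using (Vec; []; _∷_)
  open import Data.Product using (_,_)
  open import Relation.Binary.PropositionalEquality
    using (_≡_; refl; sym; trans; cong; cong₂)
  open import Relation.Binary.Construct.Closure.ReflexiveTransitive using (ε; _◅_)
  open LamT
  open Substitution
  open Conversion
  open Confluence

  erase : Tm → Tm
  erase (var x)        = var x
  erase (lam ρ t)      = lam N (erase t)
  erase (app t s)      = app (erase t) (erase s)
  erase zer            = zer
  erase (suc′ t)       = suc′ (erase t)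
  erase (nrec ρ r s t) = nrec N (erase r) (erase s) (erase t)

  erase-ren : ∀ f t → erase (rename f t) ≡ rename f (erase t)
  erase-ren f (var x)        = refl
  erase-ren f (lam ρ t)      = cong (lam N) (erase-ren (ext f) t)
  erase-ren f (app t s)      = cong₂ app (erase-ren f t) (erase-ren f s)
  erase-ren f zer            = refl
  erase-ren f (suc′ t)       = cong suc′ (erase-ren f t)
  erase-ren f (nrec ρ r s t) = cong₃ (nrec N) (erase-ren f r) (erase-ren f s) (erase-ren f t)

  erase-w : ∀ t → erase (w t) ≡ w (erase t)
  erase-w = erase-ren suc

  erase-sub : ∀ {σ τ} → (∀ x → erase (σ x) ≡ τ x) → ∀ t → erase (subst σ t) ≡ subst τ (erase t)
  erase-sub h (var x)        = h x
  erase-sub {σ} {τ} h (lam ρ t) = cong (lam N) (erase-sub h′ t)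
    where h′ : ∀ x → erase (exts σ x) ≡ exts τ x
          h′ zero    = refl
          h′ (suc x) = trans (erase-w (σ x)) (cong w (h x))
  erase-sub h (app t s)      = cong₂ app (erase-sub h t) (erase-sub h s)
  erase-sub h zer            = refl
  erase-sub h (suc′ t)       = cong suc′ (erase-sub h t)
  erase-sub h (nrec ρ r s t) = cong₃ (nrec N) (erase-sub h r) (erase-sub h s) (erase-sub h t)

  erase-[0:=] : ∀ t r → erase (t [0:= r ]) ≡ erase t [0:= erase r ]
  erase-[0:=] t r = erase-sub single-erase t
    where single-erase : ∀ x → erase (single r x) ≡ single (erase r) x
          single-erase zero    = refl
          single-erase (suc x) = refl

  erase-num : ∀ k → erase (num k) ≡ num k
  erase-num zero    = refl
  erase-num (suc k) = cong suc′ (erase-num k)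

  erase-apps : ∀ {n} (ms : Vec ℕ n) Y → erase (apps Y ms) ≡ apps (erase Y) ms
  erase-apps []       Y = refl
  erase-apps (m ∷ ms) Y =
    trans (erase-apps ms (app Y (num m))) (cong (λ z → apps (app (erase Y) z) ms) (erase-num m))

  erase-num-inv : ∀ k u → erase u ≡ num k → u ≡ num k
  erase-num-inv zero    zer      refl = refl
  erase-num-inv (suc k) (suc′ u) e    = cong suc′ (erase-num-inv k u (suc′-injective e))
    where suc′-injective : ∀ {a b} → suc′ a ≡ suc′ b → a ≡ b
          suc′-injective refl = refl
  erase-num-inv zero    (var _)        ()
  erase-num-inv zero    (lam _ _)      ()
  erase-num-inv zero    (app _ _)      ()
  erase-num-inv zero    (suc′ _)       ()
  erase-num-inv zero    (nrec _ _ _ _) ()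
  erase-num-inv (suc k) (var _)        ()
  erase-num-inv (suc k) (lam _ _)      ()
  erase-num-inv (suc k) (app _ _)      ()
  erase-num-inv (suc k) zer            ()
  erase-num-inv (suc k) (nrec _ _ _ _) ()

  Lift : Tm → Tm → Set
  Lift u v = Σ Tm (λ u′ → (u ⟶ u′) × (erase u′ ≡ v))

  lift : ∀ u {v} → erase u ⟶ v → Lift u v
  lift (lam ρ t) (ξ-lam st) with lift t st
  ... | t′ , t⟶t′ , refl = lam ρ t′ , ξ-lam t⟶t′ , refl
  lift (app (lam ρ t) s) β = t [0:= s ] , β , erase-[0:=] t s
  lift (app t s) (ξ-appL st) with lift t st
  ... | t′ , t⟶t′ , refl = app t′ s , ξ-appL t⟶t′ , refl
  lift (app t s) (ξ-appR st) with lift s st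
  ... | s′ , s⟶s′ , refl = app t s′ , ξ-appR s⟶s′ , refl
  lift (suc′ t) (ξ-suc st) with lift t st
  ... | t′ , t⟶t′ , refl = suc′ t′ , ξ-suc t⟶t′ , refl
  lift (nrec ρ r s zer) nrec-0 = r , nrec-0 , refl
  lift (nrec ρ r s (suc′ t)) nrec-S = app (app s t) (nrec ρ r s t) , nrec-S , refl
  lift (nrec ρ r s t) (ξ-nrec₁ st) with lift r st
  ... | r′ , r⟶r′ , refl = nrec ρ r′ s t , ξ-nrec₁ r⟶r′ , refl
  lift (nrec ρ r s t) (ξ-nrec₂ st) with lift s st
  ... | s′ , s⟶s′ , refl = nrec ρ r s′ t , ξ-nrec₂ s⟶s′ , refl
  lift (nrec ρ r s t) (ξ-nrec₃ st) with lift t st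
  ... | t′ , t⟶t′ , refl = nrec ρ r s t′ , ξ-nrec₃ t⟶t′ , refl

  lift* : ∀ u {v} → erase u ⟶* v → Σ Tm (λ u′ → (u ⟶* u′) × (erase u′ ≡ v))
  lift* u ε = u , ε , refl
  lift* u (st ◅ steps) with lift u st
  ... | u₁ , u⟶u₁ , refl with lift* u₁ steps
  ... | u₂ , u₁⟶*u₂ , e = u₂ , u⟶u₁ ◅ u₁⟶*u₂ , e

  convert-to-num : ∀ u k → erase u ≃ num k → u ≃ num k
  convert-to-num u k e with church-rosser e
  ... | c , eu⟶*c , k⟶*c with lift* u eu⟶*c
  ... | u′ , u⟶*u′ , refl =
    ≃trans (⟶*≃ u⟶*u′) (≡≃ (erase-num-inv k u′ (num-normal* k k⟶*c)))

-- The typed CPS translation: the translation of a λμT typing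
-- derivation is a well-typed λT-term erasing to the untyped translation.

module TypedCPS where

  open import Data.Nat using (zero; suc)
  open import Data.List using ([]; _∷_)
  open import Data.Product using (_,_)
  open import Relation.Binary.PropositionalEquality
    using (_≡_; refl; trans; cong; cong₂)
  open LamT
  open Substitution
  open CPS
  open Erasure
  open Readback using (readback; φ₀; ψ₀)

  mutual
    Cont : Ty → Ty
    Cont N       = N ⇒ N
    Cont (σ ⇒ τ) = (Comp σ ⇒ Comp τ) ⇒ N

    Comp : Ty → Ty
    Comp ρ = Cont ρ ⇒ N

  ren-⊢ : ∀ {Γ Γ′ t σ} (f : ℕ → ℕ) → (∀ {x τ} → Γ ∋ x ∶ τ → Γ′ ∋ f x ∶ τ)
        → Γ ⊢ t ∶ σ → Γ′ ⊢ rename f t ∶ σ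
  ren-⊢ f h (⊢var p)      = ⊢var (h p)
  ren-⊢ {Γ} {Γ′} f h (⊢lam {ρ = ρ} d) = ⊢lam (ren-⊢ (ext f) h′ d)
    where h′ : ∀ {x τ} → (ρ ∷ Γ) ∋ x ∶ τ → (ρ ∷ Γ′) ∋ ext f x ∶ τ
          h′ here      = here
          h′ (there p) = there (h p)
  ren-⊢ f h (⊢app d e)    = ⊢app (ren-⊢ f h d) (ren-⊢ f h e)
  ren-⊢ f h ⊢zer          = ⊢zer
  ren-⊢ f h (⊢suc d)      = ⊢suc (ren-⊢ f h d)
  ren-⊢ f h (⊢nrec d e g) = ⊢nrec (ren-⊢ f h d) (ren-⊢ f h e) (ren-⊢ f h g)

  w-⊢ : ∀ {Γ t σ τ} → Γ ⊢ t ∶ σ → (τ ∷ Γ) ⊢ w t ∶ σ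
  w-⊢ = ren-⊢ suc there

  retᵗ : Tm → Tm
  retᵗ V = lam (N ⇒ N) (app (var 0) (w V))

  ηᵗ : Ty → Tm → Tm
  ηᵗ ρ X = lam (Cont ρ) (app (w X) (var 0))

  argKᵗ : Ty → Ty → Tm → Tm → Tm
  argKᵗ σ τ Y K = lam (Comp σ ⇒ Comp τ) (app (app (var 0) (w Y)) (w K))

  sucKᵗ : Tm → Tm
  sucKᵗ K = lam N (app (w K) (suc′ (var 0)))

  stepKᵗ : Ty → Tm
  stepKᵗ ρ = argKᵗ N (ρ ⇒ ρ) (retᵗ (var 2)) (argKᵗ ρ ρ (ηᵗ ρ (var 1)) (var 0))

  stepCPSᵗ : Ty → Tm → Tm
  stepCPSᵗ ρ X = lam N (lam (Comp ρ) (lam (Cont ρ) (app (w (w (w X))) (stepKᵗ ρ))))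

  nrecKᵗ : Ty → Tm → Tm → Tm → Tm
  nrecKᵗ ρ R X K = lam N (app (nrec (Comp ρ) (w R) (w (stepCPSᵗ ρ X)) (var 0)) (w K))

  retᵗ-⊢ : ∀ {Θ V} → Θ ⊢ V ∶ N → Θ ⊢ retᵗ V ∶ Comp N
  retᵗ-⊢ ⊢V = ⊢lam (⊢app (⊢var here) (w-⊢ ⊢V))

  ηᵗ-⊢ : ∀ {Θ ρ X} → Θ ⊢ X ∶ Comp ρ → Θ ⊢ ηᵗ ρ X ∶ Comp ρ
  ηᵗ-⊢ ⊢X = ⊢lam (⊢app (w-⊢ ⊢X) (⊢var here))

  argKᵗ-⊢ : ∀ {Θ σ τ Y K} → Θ ⊢ Y ∶ Comp σ → Θ ⊢ K ∶ Cont τ → Θ ⊢ argKᵗ σ τ Y K ∶ Cont (σ ⇒ τ)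
  argKᵗ-⊢ ⊢Y ⊢K = ⊢lam (⊢app (⊢app (⊢var here) (w-⊢ ⊢Y)) (w-⊢ ⊢K))

  sucKᵗ-⊢ : ∀ {Θ K} → Θ ⊢ K ∶ Cont N → Θ ⊢ sucKᵗ K ∶ Cont N
  sucKᵗ-⊢ ⊢K = ⊢lam (⊢app (w-⊢ ⊢K) (⊢suc (⊢var here)))

  stepCPSᵗ-⊢ : ∀ {Θ ρ X} → Θ ⊢ X ∶ Comp (N ⇒ ρ ⇒ ρ) → Θ ⊢ stepCPSᵗ ρ X ∶ N ⇒ Comp ρ ⇒ Comp ρ
  stepCPSᵗ-⊢ {ρ = ρ} ⊢X = ⊢lam (⊢lam (⊢lam (⊢app (w-⊢ (w-⊢ (w-⊢ ⊢X)))
    (argKᵗ-⊢ {σ = N} {τ = ρ ⇒ ρ} (retᵗ-⊢ (⊢var (there (there here))))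
      (argKᵗ-⊢ {σ = ρ} {τ = ρ} (ηᵗ-⊢ (⊢var (there here))) (⊢var here))))))

  nrecKᵗ-⊢ : ∀ {Θ ρ R X K} → Θ ⊢ R ∶ Comp ρ → Θ ⊢ X ∶ Comp (N ⇒ ρ ⇒ ρ) → Θ ⊢ K ∶ Cont ρ
           → Θ ⊢ nrecKᵗ ρ R X K ∶ Cont N
  nrecKᵗ-⊢ ⊢R ⊢X ⊢K = ⊢lam (⊢app (⊢nrec (w-⊢ ⊢R) (w-⊢ (stepCPSᵗ-⊢ ⊢X)) (⊢var here)) (w-⊢ ⊢K))

  erase-retᵗ : ∀ V → erase (retᵗ V) ≡ ret (erase V)
  erase-retᵗ V = cong (λ z → L (app (var 0) z)) (erase-w V)

  erase-ηᵗ : ∀ ρ X → erase (ηᵗ ρ X) ≡ η (erase X)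
  erase-ηᵗ ρ X = cong (λ z → L (app z (var 0))) (erase-w X)

  erase-argKᵗ : ∀ σ τ Y K → erase (argKᵗ σ τ Y K) ≡ argK (erase Y) (erase K)
  erase-argKᵗ σ τ Y K = cong₂ (λ a b → L (app (app (var 0) a) b)) (erase-w Y) (erase-w K)

  erase-stepCPSᵗ : ∀ ρ X → erase (stepCPSᵗ ρ X) ≡ stepCPS (erase X)
  erase-stepCPSᵗ ρ X = cong₂ (λ a b → L (L (L (app a b))))
    (trans (erase-w _) (cong w (trans (erase-w _) (cong w (erase-w X)))))
    (trans (erase-argKᵗ N (ρ ⇒ ρ) (retᵗ (var 2)) (argKᵗ ρ ρ (ηᵗ ρ (var 1)) (var 0)))
      (cong₂ argK (erase-retᵗ (var 2))
        (trans (erase-argKᵗ ρ ρ (ηᵗ ρ (var 1)) (var 0)) (cong₂ argK (erase-ηᵗ ρ (var 1)) refl))))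

  erase-nrecKᵗ : ∀ ρ R X K → erase (nrecKᵗ ρ R X K) ≡ nrecK (erase R) (erase X) (erase K)
  erase-nrecKᵗ ρ R X K = cong₃ (λ a b c → L (app (nrec N a b (var 0)) c)) (erase-w R)
    (trans (erase-w (stepCPSᵗ ρ X)) (cong w (erase-stepCPSᵗ ρ X))) (erase-w K)

  Annotated : Ctx → Ty → Tm → Set
  Annotated Θ σ u = Σ Tm (λ X → (Θ ⊢ X ∶ σ) × (erase X ≡ u))

  weakenA : ∀ {Θ σ τ u} → Annotated Θ σ u → Annotated (τ ∷ Θ) σ (w u)
  weakenA (X , ⊢X , X↦u) = w X , w-⊢ ⊢X , trans (erase-w X) (cong w X↦u)

  record TypedEnv (Γ Δ Θ : Ctx) (φ ψ : ℕ → Tm) : Set where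
    field
      termVar : ∀ {x σ} → Γ ∋ x ∶ σ → Annotated Θ (Comp σ) (φ x)
      contVar : ∀ {α σ} → Δ ∋ α ∶ σ → Annotated Θ (Cont σ) (ψ α)
  open TypedEnv

  weakenEnv : ∀ {Γ Δ Θ φ ψ τ} → TypedEnv Γ Δ Θ φ ψ → TypedEnv Γ Δ (τ ∷ Θ) (wₑ φ) (wₑ ψ)
  termVar (weakenEnv E) p = weakenA (termVar E p)
  contVar (weakenEnv E) p = weakenA (contVar E p)

  lamEnvᵗ : ∀ {Γ Δ Θ φ ψ ρ σ} → TypedEnv Γ Δ Θ φ ψ
          → TypedEnv (ρ ∷ Γ) Δ (Comp ρ ∷ Cont (ρ ⇒ σ) ∷ Θ) (lamEnv φ) (wₑ (wₑ ψ))
  termVar (lamEnvᵗ {ρ = ρ} E) here      = ηᵗ ρ (var 0) , ηᵗ-⊢ (⊢var here) , refl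
  termVar (lamEnvᵗ E)         (there p) = termVar (weakenEnv (weakenEnv E)) p
  contVar (lamEnvᵗ E)         p         = contVar (weakenEnv (weakenEnv E)) p

  μEnvᵗ : ∀ {Γ Δ Θ φ ψ ρ} → TypedEnv Γ Δ Θ φ ψ → TypedEnv Γ (ρ ∷ Δ) (Cont ρ ∷ Θ) (wₑ φ) (μEnv ψ)
  termVar (μEnvᵗ E) p         = termVar (weakenEnv E) p
  contVar (μEnvᵗ E) here      = var 0 , ⊢var here , refl
  contVar (μEnvᵗ E) (there p) = contVar (weakenEnv E) p

  closedEnv : TypedEnv [] [] [] φ₀ ψ₀
  termVar closedEnv ()
  contVar closedEnv ()

  mutual
    typedCPS : ∀ {Γ Δ Θ t ρ φ ψ} → Γ S.︔ Δ ⊢ t ∶ ρ → TypedEnv Γ Δ Θ φ ψ → Annotated Θ (Comp ρ) (cps φ ψ t)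
    typedCPS (S.⊢var p) E = termVar E p
    typedCPS (S.⊢lam {ρ = ρ} {σ} d) E with typedCPS d (lamEnvᵗ {σ = σ} E)
    ... | X , ⊢X , X↦ =
      lam (Cont (ρ ⇒ σ)) (app (var 0) (lam (Comp ρ) X)) , ⊢lam (⊢app (⊢var here) (⊢lam ⊢X)) ,
      cong (λ z → L (app (var 0) (L z))) X↦
    typedCPS (S.⊢app {σ = σ} {τ} dt ds) E
      with weakenA {τ = Cont τ} (typedCPS dt E) | weakenA {τ = Cont τ} (typedCPS ds E)
    ... | Xt , ⊢Xt , Xt↦ | Xs , ⊢Xs , Xs↦ =
      lam (Cont τ) (app Xt (argKᵗ σ τ Xs (var 0))) , ⊢lam (⊢app ⊢Xt (argKᵗ-⊢ ⊢Xs (⊢var here))) ,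
      cong₂ (λ a b → L (app a b)) Xt↦ (trans (erase-argKᵗ σ τ Xs (var 0)) (cong (λ z → argK z (var 0)) Xs↦))
    typedCPS (S.⊢μ {ρ = ρ} dc) E with typedCPSᶜ dc (μEnvᵗ E)
    ... | X , ⊢X , X↦ = lam (Cont ρ) X , ⊢lam ⊢X , cong L X↦
    typedCPS S.⊢zer E = lam (Cont N) (app (var 0) zer) , ⊢lam (⊢app (⊢var here) ⊢zer) , refl
    typedCPS (S.⊢suc dt) E with weakenA {τ = Cont N} (typedCPS dt E)
    ... | Xt , ⊢Xt , Xt↦ = lam (Cont N) (app Xt (sucKᵗ (var 0))) , ⊢lam (⊢app ⊢Xt (sucKᵗ-⊢ (⊢var here))) ,
      cong (λ a → L (app a (sucK (var 0)))) Xt↦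
    typedCPS (S.⊢nrec {ρ = ρ} dr ds dt) E
      with weakenA {τ = Cont ρ} (typedCPS dr E) | weakenA {τ = Cont ρ} (typedCPS ds E)
         | weakenA {τ = Cont ρ} (typedCPS dt E)
    ... | Xr , ⊢Xr , Xr↦ | Xs , ⊢Xs , Xs↦ | Xt , ⊢Xt , Xt↦ =
      lam (Cont ρ) (app Xt (nrecKᵗ ρ Xr Xs (var 0))) ,
      ⊢lam (⊢app ⊢Xt (nrecKᵗ-⊢ ⊢Xr ⊢Xs (⊢var here))) ,
      cong₂ (λ a b → L (app a b)) Xt↦
        (trans (erase-nrecKᵗ ρ Xr Xs (var 0)) (cong₂ (λ a b → nrecK a b (var 0)) Xr↦ Xs↦))

    typedCPSᶜ : ∀ {Γ Δ Θ c φ ψ} → Γ S.︔ Δ ⊢ᶜ c → TypedEnv Γ Δ Θ φ ψ → Annotated Θ N (cpsᶜ φ ψ c)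
    typedCPSᶜ (S.⊢cmd dt p) E with typedCPS dt E | contVar E p
    ... | X , ⊢X , X↦ | K , ⊢K , K↦ = app X K , ⊢app ⊢X ⊢K , cong₂ app X↦ K↦

  readbackᵗ : ℕ → Tm → Tm
  readbackᵗ zero    X = app X (lam N (var 0))
  readbackᵗ (suc n) X =
    lam N (readbackᵗ n (lam (Cont (arrN n)) (app (w (w X)) (argKᵗ N (arrN n) (retᵗ (var 1)) (var 0)))))

  readbackᵗ-⊢ : ∀ {Γ} n {X} → Γ ⊢ X ∶ Comp (arrN n) → Γ ⊢ readbackᵗ n X ∶ arrN n
  readbackᵗ-⊢ zero    ⊢X = ⊢app ⊢X (⊢lam (⊢var here))
  readbackᵗ-⊢ (suc n) ⊢X = ⊢lam (readbackᵗ-⊢ n (⊢lam (⊢app (w-⊢ (w-⊢ ⊢X))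
    (argKᵗ-⊢ {σ = N} (retᵗ-⊢ (⊢var (there here))) (⊢var here)))))

  erase-readbackᵗ : ∀ n X → erase (readbackᵗ n X) ≡ readback n (erase X)
  erase-readbackᵗ zero    X = refl
  erase-readbackᵗ (suc n) X = cong L (trans (erase-readbackᵗ n _)
    (cong (λ z → readback n (L (app z (argK (ret (var 1)) (var 0)))))
      (trans (erase-w (w X)) (cong w (erase-w X)))))

open Conversion using (≃trans; ≡≃)
open Readback using (cps₀; readback; readback-correct)
open Erasure using (erase; erase-apps; convert-to-num)
open TypedCPS using (typedCPS; closedEnv; readbackᵗ; readbackᵗ-⊢; erase-readbackᵗ)

theorem4p13 : (n : ℕ) (f : Vec ℕ n → ℕ) (t : LamMuT.Tm)
    → [] LamMuT.︔ [] ⊢ t ∶ arrN n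
    → (∀ (ms : Vec ℕ n) → LamMuT.apps t ms LamMuT.≃ LamMuT.num (f ms))
    → Σ LamT.Tm (λ t′ → ([] LamT.⊢ t′ ∶ arrN n)
        × (∀ (ms : Vec ℕ n) → LamT.apps t′ ms LamT.≃ LamT.num (f ms)))
theorem4p13 n f t ⊢t t-computes-f =
  let X , ⊢X , X↦cps = typedCPS ⊢t closedEnv
      erased : ∀ ms → erase (LamT.apps (readbackᵗ n X) ms) ≡ LamT.apps (readback n (cps₀ t)) ms
      erased ms = trans (erase-apps ms _) (cong (λ z → LamT.apps z ms)
                    (trans (erase-readbackᵗ n X) (cong (readback n) X↦cps)))
  in readbackᵗ n X , readbackᵗ-⊢ n ⊢X ,
     λ ms → convert-to-num _ (f ms) (≃trans (≡≃ (erased ms)) (readback-correct f t t-computes-f ms))
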